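{- For every $n\geq 1$, the sequence $J_{2n,1},J_{2n,2},\ldots,J_{2n,2n-1}$ is unimodal, i.e., there is an index $j$ with $J_{2n,1}\leq\cdots\leq J_{2n,j}\geq J_{2n,j+1}\geq\cdots\geq J_{2n,2n-1}$.
   Context: For a permutation $\pi=a_1a_2\cdots a_m$ of $[m]=\{1,\ldots,m\}$, a descent is an index $1\leq i\leq m-1$ with $a_i>a_{i+1}$. A fixed-point free involution of $[m]$ is a permutation $\pi$ with $\pi^2=\mathrm{id}$ and $\pi(i)\neq i$ for all $i$. $J_{m,j}$ denotes the number of fixed-point free involutions of $[m]$ with exactly $j$ descents. -}

module Defs where

open import Algebra.Definitions using (Involutive)
open import Data.Fin using (Fin; suc; inject₁; _>_)
import Data.Fin.Properties as Fin
open import Data.List using (List; []; _∷_; allFin; cartesianProductWith; filter; length)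
open import Data.List.Membership.Propositional using (_∈_)
open import Data.List.Membership.Propositional.Properties
  using (∈-allFin; ∈-cartesianProductWith⁺)
open import Data.List.Relation.Unary.All using ([])
open import Data.List.Relation.Unary.AllPairs using ([]; _∷_)
open import Data.List.Relation.Unary.Any using (here)
open import Data.List.Relation.Unary.Unique.Propositional using (Unique)
open import Data.List.Relation.Unary.Unique.Propositional.Properties
  using (allFin⁺; cartesianProductWith⁺)
open import Data.Nat using (ℕ; zero; suc; _≤_; _<_; _≥_; _≟_)
open import Data.Product using (_×_; _,_; ∃-syntax)
open import Data.Vec using (Vec; []; _∷_; lookup)
open import Data.Vec.Properties using (∷-injective)
open import Function.Definitions using (Bijective)
open import Relation.Binary.PropositionalEquality
  using (_≡_; _≢_; refl; sym; trans; cong)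
open import Relation.Nullary using (¬?)
open import Relation.Nullary.Decidable using (map′; _×-dec_)
open import Relation.Unary using (Decidable)

-- All words of length k over the alphabet Fin m, each listed once.
words : ∀ m k → List (Vec (Fin m) k)
words m zero    = [] ∷ []
words m (suc k) = cartesianProductWith _∷_ (allFin m) (words m k)

∈-words : ∀ {m k} (w : Vec (Fin m) k) → w ∈ words m k
∈-words []      = here refl
∈-words (a ∷ w) = ∈-cartesianProductWith⁺ _∷_ (∈-allFin a) (∈-words w)

words-unique : ∀ m k → Unique (words m k)
words-unique m zero    = [] ∷ []
words-unique m (suc k) =
  cartesianProductWith⁺ _∷_ ∷-injective (allFin⁺ m) (words-unique m k)

-- A permutation π = a₁a₂⋯aₘ is given by its word: with positions and
-- letters numbered from 0, lookup w is the map i ↦ π(i).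
record IsFixedPointFreeInvolution {m} (w : Vec (Fin m) m) : Set where
  constructor mkFPFI
  field
    permutation    : Bijective _≡_ _≡_ (lookup w)
    involutive     : Involutive _≡_ (lookup w)
    fixedPointFree : ∀ i → lookup w i ≢ i

isFixedPointFreeInvolution? :
  ∀ {m} → Decidable (IsFixedPointFreeInvolution {m})
isFixedPointFreeInvolution? w =
  map′ (λ (inv , fpf) → mkFPFI (bijective inv) inv fpf)
       (λ (mkFPFI _ inv fpf) → inv , fpf)
       (Fin.all? (λ i → lookup w (lookup w i) Fin.≟ i)
         ×-dec Fin.all? (λ i → ¬? (lookup w i Fin.≟ i)))
  where
  bijective : Involutive _≡_ (lookup w) → Bijective _≡_ _≡_ (lookup w)
  bijective inv =
      (λ {x} {y} eq → trans (sym (inv x)) (trans (cong (lookup w) eq) (inv y)))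
    , (λ y → lookup w y , λ { refl → inv y })

-- A word of length suc n has n potential descent positions; inject₁ i and
-- suc i are the adjacent positions i and i + 1.
IsDescent : ∀ {m n} → Vec (Fin m) (suc n) → Fin n → Set
IsDescent w i = lookup w (inject₁ i) > lookup w (suc i)

isDescent? : ∀ {m n} (w : Vec (Fin m) (suc n)) → Decidable (IsDescent w)
isDescent? w i = lookup w (suc i) Fin.<? lookup w (inject₁ i)

descents : ∀ {m k} → Vec (Fin m) k → ℕ
descents []                    = 0
descents {k = suc n} w@(_ ∷ _) = length (filter (isDescent? w) (allFin n))

J : ℕ → ℕ → ℕ
J m j = length (filter
  (λ w → isFixedPointFreeInvolution? w ×-dec (descents w ≟ j)) (words m m))

-- The finite sequence a lo, a (lo + 1), …, a hi is unimodal.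
Unimodal : (ℕ → ℕ) → ℕ → ℕ → Set
Unimodal a lo hi = ∃[ j ]
    (lo ≤ j × j ≤ hi)
  × (∀ i → lo ≤ i → i < j → a i ≤ a (suc i))
  × (∀ i → j ≤ i → i < hi → a i ≥ a (suc i))

{-# OPTIONS --safe #-}

-- Extend an involution w of [m] by w(0) = 0 and w(m+1) = m+1, and number the
-- gaps between consecutive positions (or values) 0, …, m.  Putting a value at
-- height h into gap g creates
--   δ(g,h) = 1 - [w(g) > w(g+1)] - d(g,h),  d(g,h) = [w(g) ≤ h] - [w(g+1) ≤ h],
-- new descents, which is 0 or 1, and inserting a 2-cycle into gaps g and h
-- creates δ(g,h) + δ(h,g) of them, or 1 + δ(g,g) when g = h.  The sums of
-- d(g,h), of d(g,h)d(h,g) and of d(g,g) telescope to m+1, m+1 and 1, so the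
-- number of insertions creating 0, 1 or 2 descents depends on m and des w only.
-- Marking one letter of the inserted 2-cycle makes insertion a bijection onto the
-- fixed-point-free involutions of [m+2] with one of their m+2 letters marked, hence
--   (m+2) J(m+2,j) = (j(j+1)+m) J(m,j) + 2((m-j+1)(j-1)+1) J(m,j-1)
--                    + ((m-j+2)(m-j+3)+m) J(m,j-2).
-- Symmetry J(m,j) = J(m,m-j) and monotonicity for j ≤ m/2 follow by induction,
-- the latter by summation by parts, where all coefficients are nonnegative.
module Submission where

open import Defs
open import Algebra.Definitions using (Involutive)
open import Data.Empty using (⊥-elim)
open import Data.Fin as Fin using (Fin; zero; suc; toℕ; fromℕ; fromℕ<; inject₁; punchIn; punchOut)
import Data.Fin.Properties as Fin
open import Data.Integer as ℤ using (ℤ; +_; -[1+_]; 0ℤ; 1ℤ; _+_; _*_; _-_; -_; +≤+)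
import Data.Integer.Properties as ℤ
open import Data.Integer.Tactic.RingSolver using (solve-∀)
open import Data.List as List
  using (List; []; _∷_; _++_; map; filter; length; cartesianProduct; allFin; upTo; applyUpTo)
open import Data.List.Membership.Propositional using (_∈_)
open import Data.List.Membership.Propositional.Properties
  using (∈-allFin; ∈-cartesianProduct⁺; ∈-cartesianProduct⁻; ∈-filter⁺; ∈-filter⁻; ∈-map⁺; ∈-map⁻)
open import Data.List.Membership.Propositional.Properties.WithK using (unique∧set⇒bag)
open import Data.List.Properties using (upTo-∷ʳ; map-tabulate; map-upTo; length-tabulate)
open import Data.List.Relation.Binary.BagAndSetEquality using (∼bag⇒↭)
open import Data.List.Relation.Binary.Permutation.Propositional as ↭ using (_↭_)
open import Data.List.Relation.Unary.Any using (here; there)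
open import Data.List.Relation.Unary.Unique.Propositional using (Unique)
open import Data.List.Relation.Unary.Unique.Propositional.Properties
  using (allFin⁺; cartesianProduct⁺; filter⁺; map⁺)
open import Data.Nat as ℕ using (ℕ; zero; suc; _≤_; _<_; _≥_; z≤n; s≤s; s≤s⁻¹)
import Data.Nat.Properties as ℕ
open import Data.Product using (_×_; _,_; proj₁; proj₂; ∃-syntax)
open import Data.Sum using (_⊎_; inj₁; inj₂)
open import Data.Vec using (Vec; []; _∷_; lookup; tabulate)
open import Data.Vec.Properties using (lookup∘tabulate; tabulate∘lookup; tabulate-cong)
open import Function using (_∘_; id)
open import Function.Bundles using (mk⇔)
open import Relation.Binary.PropositionalEquality
  using (_≡_; _≢_; refl; sym; trans; cong; cong₂; subst; subst₂; module ≡-Reasoning)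
open import Relation.Nullary using (Dec; yes; no; ¬_)
open import Relation.Nullary.Decidable using (_×-dec_)
open import Relation.Unary using (Decidable)

open ≡-Reasoning

private
  variable
    A B : Set

-- Finite sums

∑ : List A → (A → ℤ) → ℤ
∑ []       f = 0ℤ
∑ (x ∷ xs) f = f x + ∑ xs f

∑-cong : (xs : List A) {f g : A → ℤ} → (∀ {x} → x ∈ xs → f x ≡ g x) → ∑ xs f ≡ ∑ xs g
∑-cong []       eq = refl
∑-cong (x ∷ xs) eq = cong₂ _+_ (eq (here refl)) (∑-cong xs (eq ∘ there))

∑-++ : (xs ys : List A) (f : A → ℤ) → ∑ (xs ++ ys) f ≡ ∑ xs f + ∑ ys f
∑-++ []       ys f = sym (ℤ.+-identityˡ _)
∑-++ (x ∷ xs) ys f = trans (cong (_+_ (f x)) (∑-++ xs ys f)) (sym (ℤ.+-assoc (f x) _ _))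

∑-map : (h : A → B) (xs : List A) (f : B → ℤ) → ∑ (map h xs) f ≡ ∑ xs (f ∘ h)
∑-map h []       f = refl
∑-map h (x ∷ xs) f = cong (_+_ (f (h x))) (∑-map h xs f)

∑-↭ : {xs ys : List A} → xs ↭ ys → (f : A → ℤ) → ∑ xs f ≡ ∑ ys f
∑-↭ ↭.refl         f = refl
∑-↭ (↭.prep x p)   f = cong (_+_ (f x)) (∑-↭ p f)
∑-↭ (↭.swap x y p) f = trans (cong (λ s → f x + (f y + s)) (∑-↭ p f)) (exchange (f x) (f y) _)
  where
  exchange : ∀ a b c → a + (b + c) ≡ b + (a + c)
  exchange = solve-∀
∑-↭ (↭.trans p q)  f = trans (∑-↭ p f) (∑-↭ q f)

∑-+ : (xs : List A) (f g : A → ℤ) → ∑ xs (λ x → f x + g x) ≡ ∑ xs f + ∑ xs g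
∑-+ []       f g = refl
∑-+ (x ∷ xs) f g = trans (cong (_+_ (f x + g x)) (∑-+ xs f g)) (interchange (f x) (g x) _ _)
  where
  interchange : ∀ a b c d → (a + b) + (c + d) ≡ (a + c) + (b + d)
  interchange = solve-∀

∑-*ˡ : (xs : List A) (c : ℤ) (f : A → ℤ) → ∑ xs (λ x → c * f x) ≡ c * ∑ xs f
∑-*ˡ []       c f = sym (ℤ.*-zeroʳ c)
∑-*ˡ (x ∷ xs) c f = trans (cong (_+_ (c * f x)) (∑-*ˡ xs c f)) (sym (ℤ.*-distribˡ-+ c (f x) _))

∑-neg : (xs : List A) (f : A → ℤ) → ∑ xs (λ x → - f x) ≡ - ∑ xs f
∑-neg []       f = refl
∑-neg (x ∷ xs) f = trans (cong (_+_ (- f x)) (∑-neg xs f)) (sym (ℤ.neg-distrib-+ (f x) _))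

∑-- : (xs : List A) (f g : A → ℤ) → ∑ xs (λ x → f x - g x) ≡ ∑ xs f - ∑ xs g
∑-- xs f g = trans (∑-+ xs f (λ x → - g x)) (cong (_+_ (∑ xs f)) (∑-neg xs g))

∑-const : (xs : List A) (c : ℤ) → ∑ xs (λ _ → c) ≡ + length xs * c
∑-const []       c = sym (ℤ.*-zeroˡ c)
∑-const (x ∷ xs) c = trans (cong (_+_ c) (∑-const xs c)) (sym (ℤ.suc-* (+ length xs) c))

∑-swap : (xs : List A) (ys : List B) (f : A → B → ℤ) →
         ∑ xs (λ x → ∑ ys (f x)) ≡ ∑ ys (λ y → ∑ xs (λ x → f x y))
∑-swap []       ys f = sym (trans (∑-const ys 0ℤ) (ℤ.*-zeroʳ (+ length ys)))
∑-swap (x ∷ xs) ys f = trans (cong (_+_ (∑ ys (f x))) (∑-swap xs ys f))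
  (sym (∑-+ ys (f x) (λ y → ∑ xs (λ z → f z y))))

∑-× : (xs : List A) (ys : List B) (f : A × B → ℤ) →
      ∑ (cartesianProduct xs ys) f ≡ ∑ xs (λ x → ∑ ys (λ y → f (x , y)))
∑-× []       ys f = refl
∑-× (x ∷ xs) ys f = trans (∑-++ (map (_,_ x) ys) (cartesianProduct xs ys) f)
  (cong₂ _+_ (∑-map (_,_ x) ys f) (∑-× xs ys f))

-- Iverson brackets and counting

⟦_⟧ : {P : Set} → Dec P → ℤ
⟦ yes _ ⟧ = 1ℤ
⟦ no  _ ⟧ = 0ℤ

⟦⟧-yes : {P : Set} (P? : Dec P) → P → ⟦ P? ⟧ ≡ 1ℤ
⟦⟧-yes (yes _) p = refl
⟦⟧-yes (no ¬p) p = ⊥-elim (¬p p)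

⟦⟧-no : {P : Set} (P? : Dec P) → ¬ P → ⟦ P? ⟧ ≡ 0ℤ
⟦⟧-no (yes p) ¬p = ⊥-elim (¬p p)
⟦⟧-no (no _)  ¬p = refl

⟦⟧-cong : {P Q : Set} (P? : Dec P) (Q? : Dec Q) → (P → Q) → (Q → P) → ⟦ P? ⟧ ≡ ⟦ Q? ⟧
⟦⟧-cong (yes p) Q? to from = sym (⟦⟧-yes Q? (to p))
⟦⟧-cong (no ¬p) Q? to from = sym (⟦⟧-no Q? (¬p ∘ from))

⟦⟧-× : {P Q : Set} (P? : Dec P) (Q? : Dec Q) → ⟦ P? ×-dec Q? ⟧ ≡ ⟦ P? ⟧ * ⟦ Q? ⟧
⟦⟧-× (yes _) (yes _) = refl
⟦⟧-× (yes _) (no _)  = refl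
⟦⟧-× (no _)  Q?      = refl

length-filter-∑ : {P : A → Set} (P? : Decidable P) (xs : List A) →
                  + length (filter P? xs) ≡ ∑ xs (λ x → ⟦ P? x ⟧)
length-filter-∑ P? []       = refl
length-filter-∑ P? (x ∷ xs) with P? x
... | yes _ = cong (_+_ 1ℤ) (length-filter-∑ P? xs)
... | no  _ = trans (length-filter-∑ P? xs) (sym (ℤ.+-identityˡ _))

∑-filter : {P : A → Set} (P? : Decidable P) (xs : List A) (f : A → ℤ) →
           ∑ (filter P? xs) f ≡ ∑ xs (λ x → ⟦ P? x ⟧ * f x)
∑-filter P? []       f = refl
∑-filter P? (x ∷ xs) f with P? x
... | yes _ = cong₂ _+_ (sym (ℤ.*-identityˡ (f x))) (∑-filter P? xs f)
... | no  _ = trans (∑-filter P? xs f) (sym (ℤ.+-identityˡ _))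

∑< : ℕ → (ℕ → ℤ) → ℤ
∑< n = ∑ (upTo n)

∑<-suc : ∀ n f → ∑< (suc n) f ≡ ∑< n f + f n
∑<-suc n f = begin
  ∑< (suc n) f               ≡⟨ cong (λ xs → ∑ xs f) (upTo-∷ʳ n) ⟨
  ∑ (upTo n ++ n ∷ []) f     ≡⟨ ∑-++ (upTo n) (n ∷ []) f ⟩
  ∑< n f + (f n + 0ℤ)        ≡⟨ cong (_+_ (∑< n f)) (ℤ.+-identityʳ (f n)) ⟩
  ∑< n f + f n               ∎

∑<-cong : ∀ n {f g : ℕ → ℤ} → (∀ i → i < n → f i ≡ g i) → ∑< n f ≡ ∑< n g
∑<-cong zero            eq = refl
∑<-cong (suc n) {f} {g} eq = begin
  ∑< (suc n) f   ≡⟨ ∑<-suc n f ⟩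
  ∑< n f + f n   ≡⟨ cong₂ _+_ (∑<-cong n (λ i i<n → eq i (ℕ.m<n⇒m<1+n i<n))) (eq n ℕ.≤-refl) ⟩
  ∑< n g + g n   ≡⟨ ∑<-suc n g ⟨
  ∑< (suc n) g   ∎

∑<-const : ∀ n c → ∑< n (λ _ → c) ≡ + n * c
∑<-const zero    c = refl
∑<-const (suc n) c = begin
  ∑< (suc n) (λ _ → c)   ≡⟨ ∑<-suc n (λ _ → c) ⟩
  ∑< n (λ _ → c) + c     ≡⟨ cong (_+ c) (∑<-const n c) ⟩
  + n * c + c            ≡⟨ ℤ.+-comm (+ n * c) c ⟩
  c + + n * c            ≡⟨ ℤ.suc-* (+ n) c ⟨
  + suc n * c            ∎

-- Induction from the top of the range, where either the last terms agree or `g` itself is last. It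
-- serves both for a letter placed into gap `g` and for the two markings of a cycle that lies inside
-- one gap.
∑<-insert : ∀ {n g} {h k : ℕ → ℤ} → g < n →
            (∀ i → i < g → h i ≡ k i) → (∀ i → g < i → h (suc i) ≡ k i) →
            ∑< (suc n) h ≡ ∑< n k - k g + (h g + h (suc g))
∑<-insert {suc n} {g} {h} {k} g<1+n below above with ℕ.m≤n⇒m<n∨m≡n (ℕ.s≤s⁻¹ g<1+n)
... | inj₁ g<n = begin
  ∑< (suc (suc n)) h                               ≡⟨ ∑<-suc (suc n) h ⟩
  ∑< (suc n) h + h (suc n)                         ≡⟨ cong₂ _+_ (∑<-insert g<n below above) (above n g<n) ⟩
  ∑< n k - k g + (h g + h (suc g)) + k n           ≡⟨ rearrange (∑< n k) (k g) _ (k n) ⟩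
  (∑< n k + k n) - k g + (h g + h (suc g))         ≡⟨ cong (λ z → z - k g + (h g + h (suc g))) (∑<-suc n k) ⟨
  ∑< (suc n) k - k g + (h g + h (suc g))           ∎
  where
  rearrange : ∀ a b c d → a - b + c + d ≡ (a + d) - b + c
  rearrange = solve-∀
... | inj₂ refl = begin
  ∑< (suc (suc n)) h                               ≡⟨ ∑<-suc (suc n) h ⟩
  ∑< (suc n) h + h (suc n)                         ≡⟨ cong (_+ h (suc n)) (∑<-suc n h) ⟩
  ∑< n h + h n + h (suc n)                         ≡⟨ cong (λ z → z + h n + h (suc n)) (∑<-cong n below) ⟩
  ∑< n k + h n + h (suc n)                         ≡⟨ rearrange (∑< n k) (k n) (h n) (h (suc n)) ⟩
  (∑< n k + k n) - k n + (h n + h (suc n))         ≡⟨ cong (λ z → z - k n + (h n + h (suc n))) (∑<-suc n k) ⟨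
  ∑< (suc n) k - k n + (h n + h (suc n))           ∎
  where
  rearrange : ∀ a b c d → a + c + d ≡ (a + b) - b + (c + d)
  rearrange = solve-∀

∑<-telescope : ∀ n (f : ℕ → ℤ) → ∑< n (λ i → f i - f (suc i)) ≡ f 0 - f n
∑<-telescope zero    f = sym (ℤ.+-inverseʳ (f 0))
∑<-telescope (suc n) f = begin
  ∑< (suc n) (λ i → f i - f (suc i))                   ≡⟨ ∑<-suc n _ ⟩
  ∑< n (λ i → f i - f (suc i)) + (f n - f (suc n))     ≡⟨ cong (_+ (f n - f (suc n))) (∑<-telescope n f) ⟩
  (f 0 - f n) + (f n - f (suc n))                      ≡⟨ cancel (f 0) (f n) (f (suc n)) ⟩
  f 0 - f (suc n)                                      ∎
  where
  cancel : ∀ a b c → (a - b) + (b - c) ≡ a - c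
  cancel = solve-∀

applyUpTo≡tabulate : ∀ (h : ℕ → A) n → applyUpTo h n ≡ List.tabulate {n = n} (h ∘ toℕ)
applyUpTo≡tabulate h zero    = refl
applyUpTo≡tabulate h (suc n) = cong (h 0 ∷_) (applyUpTo≡tabulate (h ∘ suc) n)

∑-allFin : ∀ n (f : ℕ → ℤ) → ∑ (allFin n) (f ∘ toℕ) ≡ ∑< n f
∑-allFin n f = begin
  ∑ (allFin n) (f ∘ toℕ)      ≡⟨ ∑-map toℕ (allFin n) f ⟨
  ∑ (map toℕ (allFin n)) f    ≡⟨ cong (λ xs → ∑ xs f) (map-tabulate {n = n} id toℕ) ⟩
  ∑ (List.tabulate {n = n} toℕ) f  ≡⟨ cong (λ xs → ∑ xs f) (applyUpTo≡tabulate id n) ⟨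
  ∑< n f                      ∎

-- Inserting a 2-cycle, on sequences of natural numbers

-- The analogue of `punchIn` for letters numbered from 1 with a fixed sentinel 0: exactly `suc g` is
-- missed.
skip : ℕ → ℕ → ℕ
skip g       zero    = zero
skip zero    (suc x) = suc (suc x)
skip (suc g) (suc x) = suc (skip g x)

skip-≤ : ∀ {g x} → x ≤ g → skip g x ≡ x
skip-≤ z≤n       = refl
skip-≤ (s≤s x≤g) = cong suc (skip-≤ x≤g)

skip-> : ∀ {g x} → g < x → skip g x ≡ suc x
skip-> {zero}  (s≤s _)   = refl
skip-> {suc g} (s≤s g<x) = cong suc (skip-> g<x)

-- Opening gap `g` first moves gap `h` to `suc h`. This allows the two letters of a cycle to be
-- inserted in either order.
skip-skip : ∀ {g h} → g ≤ h → ∀ x → skip (suc h) (skip g x) ≡ skip g (skip h x)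
skip-skip g≤h             zero    = refl
skip-skip {h = zero}  z≤n (suc x) = refl
skip-skip {h = suc _} z≤n (suc x) = refl
skip-skip (s≤s g≤h)       (suc x) = cong suc (skip-skip g≤h x)

x≤skip : ∀ g x → x ≤ skip g x
x≤skip g       zero    = z≤n
x≤skip zero    (suc x) = ℕ.n≤1+n _
x≤skip (suc g) (suc x) = s≤s (x≤skip g x)

skip-mono : ∀ g {x y} → x ≤ y → skip g x ≤ skip g y
skip-mono g       z≤n       = z≤n
skip-mono zero    (s≤s x≤y) = s≤s (s≤s x≤y)
skip-mono (suc g) (s≤s x≤y) = s≤s (skip-mono g x≤y)

skip-cancel : ∀ g {x y} → skip g x ≤ skip g y → x ≤ y
skip-cancel g       {zero}          _ = z≤n
skip-cancel zero    {suc x} {suc y} p = s≤s⁻¹ p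
skip-cancel (suc g) {suc x} {suc y} p = s≤s (skip-cancel g (s≤s⁻¹ p))
skip-cancel zero    {suc x} {zero}  ()
skip-cancel (suc g) {suc x} {zero}  ()

L : ℕ → ℕ → ℤ
L x y = ⟦ x ℕ.≤? y ⟧

L-yes : ∀ {x y} → x ≤ y → L x y ≡ 1ℤ
L-yes {x} {y} = ⟦⟧-yes (x ℕ.≤? y)

L-no : ∀ {x y} → y < x → L x y ≡ 0ℤ
L-no {x} {y} y<x = ⟦⟧-no (x ℕ.≤? y) (ℕ.<⇒≱ y<x)

-- The bracket of `y < x`, written through `L` so that identities about descents become polynomial
-- identities.
D : ℕ → ℕ → ℤ
D x y = 1ℤ - L x y

-- Runs over the n adjacent pairs (i, i + 1) with 0 ≤ i < n.
desc : ℕ → (ℕ → ℕ) → ℤ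
desc n s = ∑< n (λ i → D (s i) (s (suc i)))

-- A letter placed between two neighbours destroys their pair and forms a new pair with each of
-- them.
desc-insert : ∀ (s t : ℕ → ℕ) {g n v} → g < n → (∀ x → t (skip g x) ≡ s x) → t (suc g) ≡ v →
              desc (suc n) t ≡ desc n s - D (s g) (s (suc g)) + (D (s g) v + D v (s (suc g)))
desc-insert s t {g} {n} {v} g<n eq tg = begin
  desc (suc n) t
    ≡⟨ ∑<-insert g<n
         (λ i i<g → cong₂ D (fixed (ℕ.<⇒≤ i<g)) (fixed i<g))
         (λ i g<i → cong₂ D (shifted g<i) (shifted (ℕ.m<n⇒m<1+n g<i))) ⟩
  desc n s - D (s g) (s (suc g)) + (D (t g) (t (suc g)) + D (t (suc g)) (t (suc (suc g))))
    ≡⟨ cong (_+_ (desc n s - D (s g) (s (suc g))))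
         (cong₂ _+_ (cong₂ D (fixed ℕ.≤-refl) tg) (cong₂ D tg (shifted ℕ.≤-refl))) ⟩
  desc n s - D (s g) (s (suc g)) + (D (s g) v + D v (s (suc g))) ∎
  where
  shifted : ∀ {x} → g < x → t (suc x) ≡ s x
  shifted {x} g<x = trans (cong t (sym (skip-> g<x))) (eq x)
  fixed : ∀ {x} → x ≤ g → t x ≡ s x
  fixed {x} x≤g = trans (cong t (sym (skip-≤ x≤g))) (eq x)

-- t arises from s by inserting a 2-cycle into the gaps g ≤ h: the new letters
-- are g + 1 and h + 2, and the old letter x is renamed to skip g (skip h x).
record Inserts (g h : ℕ) (t s : ℕ → ℕ) : Set where
  field
    g≤h  : g ≤ h
    at-g : t (suc g) ≡ suc (suc h)
    at-h : t (suc (suc h)) ≡ suc g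
    else : ∀ x → t (skip g (skip h x)) ≡ skip g (skip h (s x))

module _ (s : ℕ → ℕ) where

  d : ℕ → ℕ → ℤ
  d g h = L (s g) h - L (s (suc g)) h

  δ : ℕ → ℕ → ℤ
  δ g h = 1ℤ - D (s g) (s (suc g)) - d g h

module _ {g h : ℕ} (g≤h : g ≤ h) where

  private
    ι : ℕ → ℕ
    ι x = skip g (skip h x)

  D-ι-ι : ∀ x y → D (ι x) (ι y) ≡ D x y
  D-ι-ι x y = cong (_-_ 1ℤ) (⟦⟧-cong (ι x ℕ.≤? ι y) (x ℕ.≤? y)
    (skip-cancel h ∘ skip-cancel g) (skip-mono g ∘ skip-mono h))

  private
    ι-low : ∀ {x} → x ≤ g → ι x ≡ x
    ι-low x≤g = trans (cong (skip g) (skip-≤ (ℕ.≤-trans x≤g g≤h))) (skip-≤ x≤g)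

    ι-above-g : ∀ {x} → g < x → x < ι x
    ι-above-g {x} g<x = subst (x <_) (sym (skip-> (ℕ.≤-trans g<x (x≤skip h x)))) (s≤s (x≤skip h x))

    ι-below-h : ∀ {x} → x ≤ h → ι x ≤ suc x
    ι-below-h {x} x≤h rewrite skip-≤ x≤h with x ℕ.≤? g
    ... | yes x≤g rewrite skip-≤ x≤g = ℕ.n≤1+n x
    ... | no  x≰g rewrite skip-> (ℕ.≰⇒> x≰g) = ℕ.≤-refl

    ι-high : ∀ {x} → h < x → ι x ≡ suc (suc x)
    ι-high h<x = trans (cong (skip g) (skip-> h<x)) (skip-> (s≤s (ℕ.≤-trans g≤h (ℕ.<⇒≤ h<x))))

  -- Renaming fixes the letters up to `g` and sends all others above `suc g`.
  D-ι-g : ∀ x → D (ι x) (suc g) ≡ 1ℤ - L x g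
  D-ι-g x with x ℕ.≤? g
  ... | yes x≤g = cong (_-_ 1ℤ) (L-yes (subst (_≤ suc g) (sym (ι-low x≤g)) (ℕ.m≤n⇒m≤1+n x≤g)))
  ... | no  x≰g = cong (_-_ 1ℤ) (L-no (ℕ.≤-<-trans (ℕ.≰⇒> x≰g) (ι-above-g (ℕ.≰⇒> x≰g))))

  D-g-ι : ∀ x → D (suc g) (ι x) ≡ L x g
  D-g-ι x with x ℕ.≤? g
  ... | yes x≤g = cong (_-_ 1ℤ) (L-no (subst (_< suc g) (sym (ι-low x≤g)) (s≤s x≤g)))
  ... | no  x≰g = cong (_-_ 1ℤ) (L-yes (ℕ.≤-trans (ℕ.≰⇒> x≰g) (ℕ.<⇒≤ (ι-above-g (ℕ.≰⇒> x≰g)))))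

  -- Letters up to `h` are raised by at most one and stay below `suc (suc h)`; the others are raised
  -- by two.
  D-ι-h : ∀ x → D (ι x) (suc (suc h)) ≡ 1ℤ - L x h
  D-ι-h x with x ℕ.≤? h
  ... | yes x≤h = cong (_-_ 1ℤ) (L-yes (ℕ.≤-trans (ι-below-h x≤h) (s≤s (ℕ.m≤n⇒m≤1+n x≤h))))
  ... | no  x≰h = cong (_-_ 1ℤ) (L-no (subst (suc (suc h) <_) (sym (ι-high (ℕ.≰⇒> x≰h))) (s≤s (s≤s (ℕ.≰⇒> x≰h)))))

  D-h-ι : ∀ x → D (suc (suc h)) (ι x) ≡ L x h
  D-h-ι x with x ℕ.≤? h
  ... | yes x≤h = cong (_-_ 1ℤ) (L-no (s≤s (ℕ.≤-trans (ι-below-h x≤h) (s≤s x≤h))))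
  ... | no  x≰h = cong (_-_ 1ℤ) (L-yes (subst (suc (suc h) ≤_) (sym (ι-high (ℕ.≰⇒> x≰h))) (s≤s (s≤s (ℕ.<⇒≤ (ℕ.≰⇒> x≰h))))))

module _ {g h t s} (ins : Inserts g h t s) {n : ℕ} (h<n : h < n) where

  open Inserts ins

  private
    -- The cycle is inserted in two stages: `r` is `t` without position `suc g`, hence `s`, renamed,
    -- with the letter `suc g` put into gap `h`.
    r : ℕ → ℕ
    r x = t (skip g x)

    desc-r : desc (suc n) r ≡
             desc n s - D (s h) (s (suc h)) + (1ℤ - L (s h) g + L (s (suc h)) g)
    desc-r = begin
      desc (suc n) r
        ≡⟨ desc-insert (λ x → skip g (skip h (s x))) r h<n else
             (trans (cong t (skip-> (s≤s g≤h))) at-h) ⟩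
      _ ≡⟨ cong₂ _+_
             (cong₂ _-_ (∑<-cong n (λ i _ → D-ι-ι g≤h (s i) (s (suc i)))) (D-ι-ι g≤h (s h) (s (suc h))))
             (cong₂ _+_ (D-ι-g g≤h (s h)) (D-g-ι g≤h (s (suc h)))) ⟩
      desc n s - D (s h) (s (suc h)) + (1ℤ - L (s h) g + L (s (suc h)) g) ∎

    desc-t : desc (suc (suc n)) t ≡ desc (suc n) r - D (r g) (r (suc g))
                                    + (D (r g) (suc (suc h)) + D (suc (suc h)) (r (suc g)))
    desc-t = desc-insert r t (s≤s (ℕ.≤-trans g≤h (ℕ.<⇒≤ h<n))) (λ _ → refl) at-g

    r-low : ∀ {x} → x ≤ h → r x ≡ skip g (skip h (s x))
    r-low {x} x≤h = trans (cong r (sym (skip-≤ x≤h))) (else x)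

  -- Since `g < h`, both letters around gap `g` are still renamed old letters when the second new
  -- letter enters between them.
  desc-inserts-< : g < h → desc (suc (suc n)) t ≡ desc n s + (δ s g h + δ s h g)
  desc-inserts-< g<h = begin
    desc (suc (suc n)) t
      ≡⟨ desc-t ⟩
    desc (suc n) r - D (r g) (r (suc g)) + (D (r g) (suc (suc h)) + D (suc (suc h)) (r (suc g)))
      ≡⟨ cong₂ (λ x y → desc (suc n) r - D x y + (D x (suc (suc h)) + D (suc (suc h)) y))
           (r-low g≤h) (r-low g<h) ⟩
    _ ≡⟨ cong₂ _+_ (cong₂ _-_ desc-r (D-ι-ι g≤h (s g) (s (suc g))))
           (cong₂ _+_ (D-ι-h g≤h (s g)) (D-h-ι g≤h (s (suc g)))) ⟩
    _ ≡⟨ rearrange (desc n s) (D (s h) (s (suc h))) (D (s g) (s (suc g)))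
           (L (s h) g) (L (s (suc h)) g) (L (s g) h) (L (s (suc g)) h) ⟩
    desc n s + (δ s g h + δ s h g) ∎
    where
    rearrange : ∀ k dh dg a b a′ b′ →
      (k - dh + (1ℤ - a + b)) - dg + (1ℤ - a′ + b′) ≡
      k + ((1ℤ - dg - (a′ - b′)) + (1ℤ - dh - (a - b)))
    rearrange = solve-∀

  -- The right neighbour of the second new letter is now the first one; the two form a descent
  -- themselves, whence the extra 1.
  desc-inserts-≡ : g ≡ h → desc (suc (suc n)) t ≡ desc n s + (1ℤ + δ s g g)
  desc-inserts-≡ refl = begin
    desc (suc (suc n)) t
      ≡⟨ desc-t ⟩
    desc (suc n) r - D (r g) (r (suc g)) + (D (r g) (suc (suc g)) + D (suc (suc g)) (r (suc g)))
      ≡⟨ cong₂ (λ x y → desc (suc n) r - D x y + (D x (suc (suc g)) + D (suc (suc g)) y))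
           (r-low g≤h) (trans (cong t (skip-> ℕ.≤-refl)) at-h) ⟩
    _ ≡⟨ cong₂ _+_ (cong₂ _-_ desc-r (D-ι-g g≤h (s g)))
           (cong₂ _+_ (D-ι-h g≤h (s g)) (cong (_-_ 1ℤ) (L-no {suc (suc g)} {suc g} ℕ.≤-refl))) ⟩
    _ ≡⟨ rearrange (desc n s) (D (s g) (s (suc g))) (L (s g) g) (L (s (suc g)) g) ⟩
    desc n s + (1ℤ + δ s g g) ∎
    where
    rearrange : ∀ k dg a b →
      (k - dg + (1ℤ - a + b)) - (1ℤ - a) + (1ℤ - a + 1ℤ) ≡ k + (1ℤ + (1ℤ - dg - (a - b)))
    rearrange = solve-∀

-- Counting insertions by the number of descents they create

∑∑ : ℕ → (ℕ → ℕ → ℤ) → ℤ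
∑∑ n f = ∑< n (λ i → ∑< n (f i))

∑∑-cong : ∀ n {f g : ℕ → ℕ → ℤ} → (∀ i j → f i j ≡ g i j) → ∑∑ n f ≡ ∑∑ n g
∑∑-cong n eq = ∑<-cong n (λ i _ → ∑<-cong n (λ j _ → eq i j))

∑∑-swap : ∀ n (f : ℕ → ℕ → ℤ) → ∑∑ n f ≡ ∑∑ n (λ i j → f j i)
∑∑-swap n = ∑-swap (upTo n) (upTo n)

∑∑-+ : ∀ n (f g : ℕ → ℕ → ℤ) → ∑∑ n (λ i j → f i j + g i j) ≡ ∑∑ n f + ∑∑ n g
∑∑-+ n f g = trans (∑<-cong n (λ i _ → ∑-+ (upTo n) (f i) (g i)))
                     (∑-+ (upTo n) (λ i → ∑< n (f i)) (λ i → ∑< n (g i)))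

∑∑-- : ∀ n (f g : ℕ → ℕ → ℤ) → ∑∑ n (λ i j → f i j - g i j) ≡ ∑∑ n f - ∑∑ n g
∑∑-- n f g = trans (∑<-cong n (λ i _ → ∑-- (upTo n) (f i) (g i)))
                     (∑-- (upTo n) (λ i → ∑< n (f i)) (λ i → ∑< n (g i)))

∑∑-* : ∀ n (f g : ℕ → ℤ) → ∑∑ n (λ i j → f i * g j) ≡ ∑< n f * ∑< n g
∑∑-* n f g = begin
  ∑∑ n (λ i j → f i * g j)        ≡⟨ ∑<-cong n (λ i _ → ∑-*ˡ (upTo n) (f i) g) ⟩
  ∑< n (λ i → f i * ∑< n g)       ≡⟨ ∑<-cong n (λ i _ → ℤ.*-comm (f i) (∑< n g)) ⟩
  ∑< n (λ i → ∑< n g * f i)       ≡⟨ ∑-*ˡ (upTo n) (∑< n g) f ⟩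
  ∑< n g * ∑< n f                 ≡⟨ ℤ.*-comm (∑< n g) (∑< n f) ⟩
  ∑< n f * ∑< n g                 ∎

∑∑-*ʳ : ∀ n (f : ℕ → ℕ → ℤ) c → ∑∑ n (λ i j → f i j * c) ≡ ∑∑ n f * c
∑∑-*ʳ n f c = begin
  ∑∑ n (λ i j → f i j * c)           ≡⟨ ∑∑-cong n (λ i j → ℤ.*-comm (f i j) c) ⟩
  ∑∑ n (λ i j → c * f i j)           ≡⟨ ∑<-cong n (λ i _ → ∑-*ˡ (upTo n) c (f i)) ⟩
  ∑< n (λ i → c * ∑< n (f i))        ≡⟨ ∑-*ˡ (upTo n) c (λ i → ∑< n (f i)) ⟩
  c * ∑∑ n f                         ≡⟨ ℤ.*-comm c (∑∑ n f) ⟩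
  ∑∑ n f * c                         ∎

∑∑-const : ∀ n c → ∑∑ n (λ _ _ → c) ≡ + n * (+ n * c)
∑∑-const n c = trans (∑<-cong n (λ _ _ → ∑<-const n c)) (∑<-const n (+ n * c))

∑<-single : ∀ n {f : ℕ → ℤ} → (∀ i → i < n → f (suc i) ≡ 0ℤ) → ∑< (suc n) f ≡ f 0
∑<-single zero    {f} eq = ℤ.+-identityʳ (f 0)
∑<-single (suc n) {f} eq = begin
  ∑< (suc (suc n)) f         ≡⟨ ∑<-suc (suc n) f ⟩
  ∑< (suc n) f + f (suc n)   ≡⟨ cong₂ _+_ (∑<-single n {f} (λ i i<n → eq i (ℕ.m<n⇒m<1+n i<n))) (eq n ℕ.≤-refl) ⟩
  f 0 + 0ℤ                   ≡⟨ ℤ.+-identityʳ (f 0) ⟩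
  f 0                        ∎

-- Involutions on the natural numbers and the sums of `d` and `δ` over all gaps

record FPFInvolution (m : ℕ) (s : ℕ → ℕ) : Set where
  field
    involutive : ∀ x → s (s x) ≡ x
    zero-fixed : s 0 ≡ 0
    beyond     : ∀ {x} → m < x → s x ≡ x
    moves      : ∀ {x} → x < m → s (suc x) ≢ suc x

L-suc-≡ : ∀ {x y} → x ≢ suc y → L x (suc y) ≡ L x y
L-suc-≡ {x} {y} x≢1+y = ⟦⟧-cong (x ℕ.≤? suc y) (x ℕ.≤? y)
  (λ x≤1+y → s≤s⁻¹ (ℕ.≤∧≢⇒< x≤1+y x≢1+y)) ℕ.m≤n⇒m≤1+n

module _ {m s} (inv : FPFInvolution m s) where

  open FPFInvolution inv

  private
    M : ℕ
    M = suc m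

    s-≤ : ∀ {x y} → m ≤ y → x ≤ y → s x ≤ y
    s-≤ {x} {y} m≤y x≤y with s x ℕ.≤? y
    ... | yes sx≤y = sx≤y
    ... | no  sx≰y = ⊥-elim (sx≰y (subst (_≤ y) x≡sx x≤y))
      where
      x≡sx : x ≡ s x
      x≡sx = trans (sym (involutive x)) (beyond (ℕ.≤-<-trans m≤y (ℕ.≰⇒> sx≰y)))

    s-M : s M ≡ M
    s-M = beyond ℕ.≤-refl

    s-suc : ∀ x → s (suc x) ≢ 0
    s-suc x eq with () ← trans (sym (involutive (suc x))) (trans (cong s eq) zero-fixed)

    L-s0 : ∀ h → L (s 0) h ≡ 1ℤ
    L-s0 h = L-yes (subst (_≤ h) (sym zero-fixed) z≤n)

    L-sM : ∀ {h} → h < M → L (s M) h ≡ 0ℤ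
    L-sM {h} h<M = L-no (subst (h <_) (sym s-M) h<M)

  -- The sum telescopes to its ends, where `s 0 = 0` is within the threshold `h` and `s M = M`
  -- exceeds it.
  ∑-d-column : ∀ h → h < M → ∑< M (λ g → d s g h) ≡ 1ℤ
  ∑-d-column h h<M = trans (∑<-telescope M (λ g → L (s g) h)) (cong₂ _-_ (L-s0 h) (L-sM h<M))

  ∑∑-d : ∑∑ M (d s) ≡ + M
  ∑∑-d = begin
    ∑∑ M (d s)                 ≡⟨ ∑∑-swap M (d s) ⟩
    ∑∑ M (λ h g → d s g h)     ≡⟨ ∑<-cong M ∑-d-column ⟩
    ∑< M (λ _ → 1ℤ)            ≡⟨ ∑<-const M 1ℤ ⟩
    + M * 1ℤ                   ≡⟨ ℤ.*-identityʳ (+ M) ⟩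
    + M                        ∎

  -- As `suc g` is not fixed, `L (s (suc g)) g` equals `L (s (suc g)) (suc g)`, and the sum
  -- telescopes. The last gap is split off because `M` is fixed.
  ∑-d-diagonal : ∑< M (λ g → d s g g) ≡ 1ℤ
  ∑-d-diagonal = begin
    ∑< M (λ g → d s g g)
      ≡⟨ ∑<-suc m (λ g → d s g g) ⟩
    ∑< m (λ g → d s g g) + d s m m
      ≡⟨ cong (_+ d s m m) (∑<-cong m (λ g g<m → cong (_-_ (L (s g) g)) (sym (L-suc-≡ (moves g<m))))) ⟩
    ∑< m (λ g → L (s g) g - L (s (suc g)) (suc g)) + d s m m
      ≡⟨ cong (_+ d s m m) (∑<-telescope m (λ g → L (s g) g)) ⟩
    L (s 0) 0 - L (s m) m + (L (s m) m - L (s M) m)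
      ≡⟨ cancel (L (s 0) 0) (L (s m) m) (L (s M) m) ⟩
    L (s 0) 0 - L (s M) m
      ≡⟨ cong₂ _-_ (L-s0 0) (L-sM ℕ.≤-refl) ⟩
    1ℤ ∎
    where
    cancel : ∀ a b c → a - b + (b - c) ≡ a - c
    cancel = solve-∀

  -- Up to the correction E, which detects s a = suc h, the four products in the
  -- expansion of d g h * d h g are values of P at the corners of a unit square,
  -- so that their alternating sum telescopes in both directions.
  private
    P E : ℕ → ℕ → ℤ
    P a b = L (s a) b * L (s b) a
    E a h = L (s a) (suc h) - L (s a) h

    swap-≡ : ∀ {x y} → s x ≡ y → s y ≡ x
    swap-≡ {x} eq = trans (cong s (sym eq)) (involutive x)

    subtract-0 : ∀ a b → a * b ≡ a * b - (a - a)
    subtract-0 = solve-∀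

    -- If `s g = suc h`, then `s (suc h) = g`: the left product is 0 while `P` and `E` are 1.
    -- Otherwise raising the threshold to `suc h` changes nothing.
    LL-mixed : ∀ g h → L (s g) h * L (s (suc h)) g ≡ P g (suc h) - E g h
    LL-mixed g h with s g ℕ.≟ suc h
    ... | no  sg≢1+h rewrite L-suc-≡ sg≢1+h = subtract-0 (L (s g) h) (L (s (suc h)) g)
    ... | yes sg≡1+h rewrite swap-≡ sg≡1+h | sg≡1+h
      | L-no {suc h} {h} ℕ.≤-refl | L-yes {suc h} {suc h} ℕ.≤-refl | L-yes {g} {g} ℕ.≤-refl = refl

    -- Two thresholds are raised, yet one correction suffices: `s (suc g) = suc h` and
    -- `s (suc h) = suc g` are equivalent.
    LL-suc : ∀ g h → L (s (suc g)) h * L (s (suc h)) g ≡ P (suc g) (suc h) - E (suc g) h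
    LL-suc g h with s (suc g) ℕ.≟ suc h
    ... | no  s≢1+h rewrite L-suc-≡ s≢1+h | L-suc-≡ (s≢1+h ∘ swap-≡) =
      subtract-0 (L (s (suc g)) h) (L (s (suc h)) g)
    ... | yes s≡1+h rewrite swap-≡ s≡1+h | s≡1+h
      | L-no {suc h} {h} ℕ.≤-refl | L-yes {suc h} {suc h} ℕ.≤-refl
      | L-yes {suc g} {suc g} ℕ.≤-refl = refl

    Q : ℕ → ℕ → ℤ
    Q g h = P g h - P (suc g) h

    d*d : ∀ g h → d s g h * d s h g ≡ (Q g h - Q g (suc h)) + (E g h + E h g - E (suc g) h)
    d*d g h = begin
      (a - b) * (a′ - b′)
        ≡⟨ expand a b a′ b′ ⟩
      a * a′ - a * b′ - a′ * b + b * b′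
        ≡⟨ cong₂ (λ y z → a * a′ - y - z + b * b′) (LL-mixed g h) (LL-mixed h g) ⟩
      P g h - (P g (suc h) - E g h) - (P h (suc g) - E h g) + b * b′
        ≡⟨ cong₂ (λ y z → P g h - (P g (suc h) - E g h) - (y - E h g) + z)
             (ℤ.*-comm (L (s h) (suc g)) (L (s (suc g)) h)) (LL-suc g h) ⟩
      P g h - (P g (suc h) - E g h) - (P (suc g) h - E h g) + (P (suc g) (suc h) - E (suc g) h)
        ≡⟨ collect (P g h) (P g (suc h)) (P (suc g) h) (P (suc g) (suc h)) (E g h) (E h g) (E (suc g) h) ⟩
      (Q g h - Q g (suc h)) + (E g h + E h g - E (suc g) h) ∎
      where
      a b a′ b′ : ℤ
      a  = L (s g) h
      b  = L (s (suc g)) h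
      a′ = L (s h) g
      b′ = L (s (suc h)) g
      expand : ∀ a b a′ b′ → (a - b) * (a′ - b′) ≡ a * a′ - a * b′ - a′ * b + b * b′
      expand = solve-∀
      collect : ∀ p q r t x y z →
        p - (q - x) - (r - y) + (t - z) ≡ ((p - r) - (q - t)) + (x + y - z)
      collect = solve-∀

    ∑-E : ∀ x → ∑< M (E x) ≡ L (s x) M - L (s x) 0
    ∑-E x = begin
      ∑< M (E x)
        ≡⟨ ∑<-cong M (λ h _ → flip (L (s x) (suc h)) (L (s x) h)) ⟩
      ∑< M (λ h → - (L (s x) h - L (s x) (suc h)))
        ≡⟨ ∑-neg (upTo M) (λ h → L (s x) h - L (s x) (suc h)) ⟩
      - ∑< M (λ h → L (s x) h - L (s x) (suc h))
        ≡⟨ cong (-_) (∑<-telescope M (L (s x))) ⟩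
      - (L (s x) 0 - L (s x) M)
        ≡⟨ flip (L (s x) M) (L (s x) 0) ⟨
      L (s x) M - L (s x) 0 ∎
      where
      flip : ∀ a b → a - b ≡ - (b - a)
      flip = solve-∀

    -- Row `g` contributes 1 unless `s g = 0`, and only `g = 0` is sent to 0.
    ∑∑-E : ∑∑ M E ≡ + m
    ∑∑-E = begin
      ∑∑ M E
        ≡⟨ ∑<-cong M (λ g g<M → trans (∑-E g)
             (cong (_- L (s g) 0) (L-yes (s-≤ (ℕ.n≤1+n m) (ℕ.<⇒≤ g<M))))) ⟩
      ∑< M (λ g → 1ℤ - L (s g) 0)
        ≡⟨ ∑-- (upTo M) (λ _ → 1ℤ) (λ g → L (s g) 0) ⟩
      ∑< M (λ _ → 1ℤ) - ∑< M (λ g → L (s g) 0)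
        ≡⟨ cong₂ _-_ (∑<-const M 1ℤ)
             (trans (∑<-single m {λ g → L (s g) 0} (λ i _ → L-no (ℕ.n≢0⇒n>0 (s-suc i)))) (L-s0 0)) ⟩
      + M * 1ℤ - 1ℤ
        ≡⟨ count (+ m) ⟩
      + m ∎
      where
      count : ∀ x → (1ℤ + x) * 1ℤ - 1ℤ ≡ x
      count = solve-∀

    ∑∑-E-suc : ∑∑ M (λ g h → E (suc g) h) ≡ + M
    ∑∑-E-suc = begin
      ∑∑ M (λ g h → E (suc g) h)
        ≡⟨ ∑<-cong M (λ g g<M → trans (∑-E (suc g))
             (cong₂ _-_ (L-yes (s-≤ (ℕ.n≤1+n m) g<M)) (L-no (ℕ.n≢0⇒n>0 (s-suc g))))) ⟩
      ∑< M (λ _ → 1ℤ)  ≡⟨ ∑<-const M 1ℤ ⟩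
      + M * 1ℤ         ≡⟨ ℤ.*-identityʳ (+ M) ⟩
      + M              ∎

    -- Four corner values of `P` remain, of which `P 0 0` and `P M M` are 1 and the other two are 0.
    ∑∑-Q : ∑∑ M (λ g h → Q g h - Q g (suc h)) ≡ + 2
    ∑∑-Q = begin
      ∑∑ M (λ g h → Q g h - Q g (suc h))
        ≡⟨ ∑<-cong M (λ g _ → ∑<-telescope M (Q g)) ⟩
      ∑< M (λ g → Q g 0 - Q g M)
        ≡⟨ ∑<-cong M (λ g _ → regroup (P g 0) (P (suc g) 0) (P g M) (P (suc g) M)) ⟩
      ∑< M (λ g → (P g 0 - P g M) - (P (suc g) 0 - P (suc g) M))
        ≡⟨ ∑<-telescope M (λ g → P g 0 - P g M) ⟩
      (P 0 0 - P 0 M) - (P M 0 - P M M)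
        ≡⟨ cong₂ _-_
             (cong₂ _-_ (cong₂ _*_ (L-s0 0) (L-s0 0)) (cong₂ _*_ (L-s0 M) (L-sM (s≤s z≤n))))
             (cong₂ _-_ (cong₂ _*_ (L-sM (s≤s z≤n)) (L-s0 M)) (cong₂ _*_ L-sMM L-sMM)) ⟩
      + 2 ∎
      where
      regroup : ∀ p q r t → (p - q) - (r - t) ≡ (p - r) - (q - t)
      regroup = solve-∀
      L-sMM : L (s M) M ≡ 1ℤ
      L-sMM = L-yes (ℕ.≤-reflexive s-M)

  ∑∑-d*d : ∑∑ M (λ g h → d s g h * d s h g) ≡ + M
  ∑∑-d*d = begin
    ∑∑ M (λ g h → d s g h * d s h g)
      ≡⟨ ∑∑-cong M d*d ⟩
    ∑∑ M (λ g h → (Q g h - Q g (suc h)) + (E g h + E h g - E (suc g) h))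
      ≡⟨ ∑∑-+ M (λ g h → Q g h - Q g (suc h)) (λ g h → E g h + E h g - E (suc g) h) ⟩
    ∑∑ M (λ g h → Q g h - Q g (suc h)) + ∑∑ M (λ g h → E g h + E h g - E (suc g) h)
      ≡⟨ cong₂ _+_ ∑∑-Q (∑∑-- M (λ g h → E g h + E h g) (λ g h → E (suc g) h)) ⟩
    + 2 + (∑∑ M (λ g h → E g h + E h g) - ∑∑ M (λ g h → E (suc g) h))
      ≡⟨ cong₂ (λ y z → + 2 + (y - z)) (∑∑-+ M E (λ g h → E h g)) ∑∑-E-suc ⟩
    + 2 + (∑∑ M E + ∑∑ M (λ g h → E h g) - + M)
      ≡⟨ cong₂ (λ y z → + 2 + (y + z - + M)) ∑∑-E (trans (sym (∑∑-swap M E)) ∑∑-E) ⟩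
    + 2 + (+ m + + m - + M)
      ≡⟨ count (+ m) ⟩
    + M ∎
    where
    count : ∀ x → + 2 + (x + x - (1ℤ + x)) ≡ 1ℤ + x
    count = solve-∀

  private
    k : ℤ
    k = desc M s

    -- The bracket of a gap that is not a descent; `δ s g h` is `α g - d s g h` by definition.
    α : ℕ → ℤ
    α g = 1ℤ - D (s g) (s (suc g))

    ∑-α : ∑< M α ≡ + M - k
    ∑-α = trans (∑-- (upTo M) (λ _ → 1ℤ) (λ g → D (s g) (s (suc g))))
                  (cong (_- k) (trans (∑<-const M 1ℤ) (ℤ.*-identityʳ (+ M))))

  ∑∑-δ : ∑∑ M (δ s) ≡ + M * (+ M - k) - + M
  ∑∑-δ = begin
    ∑∑ M (δ s)
      ≡⟨ ∑∑-- M (λ g _ → α g) (d s) ⟩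
    ∑∑ M (λ g _ → α g) - ∑∑ M (d s)
      ≡⟨ cong₂ _-_ (∑∑-swap M (λ g _ → α g)) ∑∑-d ⟩
    ∑< M (λ _ → ∑< M α) - + M
      ≡⟨ cong (_- + M) (trans (∑<-const M (∑< M α)) (cong (_*_ (+ M)) ∑-α)) ⟩
    + M * (+ M - k) - + M ∎

  ∑-δ-diagonal : ∑< M (λ g → δ s g g) ≡ + M - k - 1ℤ
  ∑-δ-diagonal = trans (∑-- (upTo M) α (λ g → d s g g)) (cong₂ _-_ ∑-α ∑-d-diagonal)

  -- After expanding `δ` into `α` and `d`, the mixed terms reduce to the sum of `α`, because every
  -- column of `d` sums to 1.
  ∑∑-δ*δ : ∑∑ M (λ g h → δ s g h * δ s h g) ≡
           (+ M - k) * (+ M - k) - + 2 * (+ M - k) + + M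
  ∑∑-δ*δ = begin
    ∑∑ M (λ g h → δ s g h * δ s h g)
      ≡⟨ ∑∑-cong M (λ g h → expand (α g) (α h) (d s g h) (d s h g)) ⟩
    ∑∑ M (λ g h → (α g * α h - α g * d s h g) - (α h * d s g h - d s g h * d s h g))
      ≡⟨ ∑∑-- M (λ g h → α g * α h - α g * d s h g) (λ g h → α h * d s g h - d s g h * d s h g) ⟩
    ∑∑ M (λ g h → α g * α h - α g * d s h g) - ∑∑ M (λ g h → α h * d s g h - d s g h * d s h g)
      ≡⟨ cong₂ _-_ (∑∑-- M (λ g h → α g * α h) (λ g h → α g * d s h g))
                   (∑∑-- M (λ g h → α h * d s g h) (λ g h → d s g h * d s h g)) ⟩
    (∑∑ M (λ g h → α g * α h) - ∑∑ M (λ g h → α g * d s h g))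
      - (∑∑ M (λ g h → α h * d s g h) - ∑∑ M (λ g h → d s g h * d s h g))
      ≡⟨ cong₂ _-_ (cong₂ _-_ (trans (∑∑-* M α α) (cong₂ _*_ ∑-α ∑-α)) ∑∑-α*d)
                   (cong₂ _-_ (trans (∑∑-swap M (λ g h → α h * d s g h)) ∑∑-α*d) ∑∑-d*d) ⟩
    ((+ M - k) * (+ M - k) - (+ M - k)) - ((+ M - k) - + M)
      ≡⟨ collect (+ M - k) (+ M) ⟩
    (+ M - k) * (+ M - k) - + 2 * (+ M - k) + + M ∎
    where
    expand : ∀ a b x y → (a - x) * (b - y) ≡ (a * b - a * y) - (b * x - x * y)
    expand = solve-∀
    collect : ∀ a b → (a * a - a) - (a - b) ≡ a * a - + 2 * a + b
    collect = solve-∀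
    ∑∑-α*d : ∑∑ M (λ g h → α g * d s h g) ≡ + M - k
    ∑∑-α*d = begin
      ∑∑ M (λ g h → α g * d s h g)
        ≡⟨ ∑<-cong M (λ g g<M → trans (∑-*ˡ (upTo M) (α g) (λ h → d s h g))
             (trans (cong (_*_ (α g)) (∑-d-column g g<M)) (ℤ.*-identityʳ (α g)))) ⟩
      ∑< M α   ≡⟨ ∑-α ⟩
      + M - k  ∎

  -- Along an ascent `d` is 0 or 1, along a descent 0 or -1. The cases ruled out would put the
  -- larger value below the threshold and the smaller one above it.
  δ-bit : ∀ g h → δ s g h ≡ 0ℤ ⊎ δ s g h ≡ 1ℤ
  δ-bit g h with s g ℕ.≤? s (suc g) | s g ℕ.≤? h | s (suc g) ℕ.≤? h
  ... | yes _ | yes _ | yes _ = inj₂ refl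
  ... | yes _ | yes _ | no  _ = inj₁ refl
  ... | yes p | no ¬q | yes r = ⊥-elim (¬q (ℕ.≤-trans p r))
  ... | yes _ | no  _ | no  _ = inj₂ refl
  ... | no  _ | yes _ | yes _ = inj₁ refl
  ... | no ¬p | yes q | no ¬r = ⊥-elim (¬p (ℕ.≤-trans q (ℕ.<⇒≤ (ℕ.≰⇒> ¬r))))
  ... | no  _ | no  _ | yes _ = inj₂ refl
  ... | no  _ | no  _ | no  _ = inj₁ refl

  module _ (φ : ℤ → ℤ) where

    private
      φ₀ φ₁ φ₂ Δ₁ Δ₂ : ℤ
      φ₀ = φ k
      φ₁ = φ (k + 1ℤ)
      φ₂ = φ (k + + 2)
      Δ₁ = φ₁ - φ₀
      Δ₂ = φ₂ - + 2 * φ₁ + φ₀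

      -- Newton's forward difference formula: for bits, `x * y` is the binomial coefficient of
      -- `x + y` over 2. Only the sums of `δ` and of products of two `δ` are then needed.
      interpolate : ∀ {x y} → x ≡ 0ℤ ⊎ x ≡ 1ℤ → y ≡ 0ℤ ⊎ y ≡ 1ℤ →
                    φ (k + (x + y)) ≡ φ₀ + (x + y) * Δ₁ + (x * y) * Δ₂
      interpolate (inj₁ refl) (inj₁ refl) = trans (cong φ (ℤ.+-identityʳ k)) (identity φ₀ φ₁ φ₂)
        where
        identity : ∀ a b c → a ≡ a + 0ℤ * (b - a) + 0ℤ * (c - + 2 * b + a)
        identity = solve-∀
      interpolate (inj₁ refl) (inj₂ refl) = identity φ₀ φ₁ φ₂
        where
        identity : ∀ a b c → b ≡ a + 1ℤ * (b - a) + 0ℤ * (c - + 2 * b + a)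
        identity = solve-∀
      interpolate (inj₂ refl) (inj₁ refl) = identity φ₀ φ₁ φ₂
        where
        identity : ∀ a b c → b ≡ a + 1ℤ * (b - a) + 0ℤ * (c - + 2 * b + a)
        identity = solve-∀
      interpolate (inj₂ refl) (inj₂ refl) = identity φ₀ φ₁ φ₂
        where
        identity : ∀ a b c → c ≡ a + + 2 * (b - a) + 1ℤ * (c - + 2 * b + a)
        identity = solve-∀

      -- The diagonal correction: the two markings of a cycle inside one gap replace a single term
      -- of the double sum.
      interpolate-diagonal : ∀ {x} → x ≡ 0ℤ ⊎ x ≡ 1ℤ →
        (φ (k + (1ℤ + x)) + φ (k + (1ℤ + x))) - φ (k + (x + x)) ≡ (+ 2 * φ₁ - φ₀) + x * Δ₂
      interpolate-diagonal (inj₁ refl) =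
        trans (cong (λ z → φ₁ + φ₁ - φ z) (ℤ.+-identityʳ k)) (identity φ₀ φ₁ φ₂)
        where
        identity : ∀ a b c → (b + b) - a ≡ (+ 2 * b - a) + 0ℤ * (c - + 2 * b + a)
        identity = solve-∀
      interpolate-diagonal (inj₂ refl) = identity φ₀ φ₁ φ₂
        where
        identity : ∀ a b c → (c + c) - c ≡ (+ 2 * b - a) + 1ℤ * (c - + 2 * b + a)
        identity = solve-∀

      K : ℕ → ℕ → ℤ
      K g h = φ (k + (δ s g h + δ s h g))

      C : ℕ → ℤ
      C g = φ (k + (1ℤ + δ s g g))

    -- For fixed `h` the other letter runs over all gaps, with the term `g = h` replaced by the two
    -- markings of a cycle inside gap `h`. As `φ` is arbitrary, the coefficients count the
    -- insertions that create 0, 1 and 2 descents.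
    ∑-insertions :
      ∑< M (λ h → ∑< M (λ g → φ (k + (δ s g h + δ s h g))) - φ (k + (δ s h h + δ s h h))
                  + (φ (k + (1ℤ + δ s h h)) + φ (k + (1ℤ + δ s h h)))) ≡
      (k * (k + 1ℤ) + + m) * φ k
        + (+ 2 * ((+ m - k) * k + 1ℤ)) * φ (k + 1ℤ)
        + ((+ m - k) * (+ m - k + 1ℤ) + + m) * φ (k + + 2)
    ∑-insertions = begin
      ∑< M (λ h → ∑< M (λ g → K g h) - K h h + (C h + C h))
        ≡⟨ ∑<-cong M (λ h _ → regroup (∑< M (λ g → K g h)) (K h h) (C h)) ⟩
      ∑< M (λ h → ∑< M (λ g → K g h) + (C h + C h - K h h))
        ≡⟨ ∑-+ (upTo M) (λ h → ∑< M (λ g → K g h)) (λ h → C h + C h - K h h) ⟩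
      ∑∑ M (λ h g → K g h) + ∑< M (λ h → C h + C h - K h h)
        ≡⟨ cong₂ _+_ (trans (∑∑-swap M (λ h g → K g h)) ∑∑-K) ∑-C ⟩
      (+ M * (+ M * φ₀) + (S + S) * Δ₁ + T * Δ₂)
        + (+ M * (+ 2 * φ₁ - φ₀) + (+ M - k - 1ℤ) * Δ₂)
        ≡⟨ identity (+ m) k φ₀ φ₁ φ₂ ⟩
      _ ∎
      where
      S T : ℤ
      S = + M * (+ M - k) - + M
      T = (+ M - k) * (+ M - k) - + 2 * (+ M - k) + + M

      regroup : ∀ a b c → a - b + (c + c) ≡ a + (c + c - b)
      regroup = solve-∀

      ∑∑-K : ∑∑ M K ≡ + M * (+ M * φ₀) + (S + S) * Δ₁ + T * Δ₂
      ∑∑-K = begin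
        ∑∑ M K
          ≡⟨ ∑∑-cong M (λ g h → interpolate (δ-bit g h) (δ-bit h g)) ⟩
        ∑∑ M (λ g h → φ₀ + (δ s g h + δ s h g) * Δ₁ + (δ s g h * δ s h g) * Δ₂)
          ≡⟨ trans (∑∑-+ M (λ g h → φ₀ + (δ s g h + δ s h g) * Δ₁) (λ g h → (δ s g h * δ s h g) * Δ₂))
               (cong₂ _+_ (∑∑-+ M (λ _ _ → φ₀) (λ g h → (δ s g h + δ s h g) * Δ₁))
                          (∑∑-*ʳ M (λ g h → δ s g h * δ s h g) Δ₂)) ⟩
        ∑∑ M (λ _ _ → φ₀) + ∑∑ M (λ g h → (δ s g h + δ s h g) * Δ₁) + ∑∑ M (λ g h → δ s g h * δ s h g) * Δ₂
          ≡⟨ cong₂ _+_ (cong₂ _+_ (∑∑-const M φ₀) ∑∑-linear) (cong (_* Δ₂) ∑∑-δ*δ) ⟩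
        + M * (+ M * φ₀) + (S + S) * Δ₁ + T * Δ₂ ∎
        where
        ∑∑-linear : ∑∑ M (λ g h → (δ s g h + δ s h g) * Δ₁) ≡ (S + S) * Δ₁
        ∑∑-linear = trans (∑∑-*ʳ M (λ g h → δ s g h + δ s h g) Δ₁) (cong (_* Δ₁)
          (trans (∑∑-+ M (δ s) (λ g h → δ s h g))
            (cong₂ _+_ ∑∑-δ (trans (sym (∑∑-swap M (δ s))) ∑∑-δ))))

      ∑-C : ∑< M (λ h → C h + C h - K h h) ≡ + M * (+ 2 * φ₁ - φ₀) + (+ M - k - 1ℤ) * Δ₂
      ∑-C = begin
        ∑< M (λ h → C h + C h - K h h)
          ≡⟨ ∑<-cong M (λ h _ → trans (interpolate-diagonal (δ-bit h h))
               (cong (_+_ (+ 2 * φ₁ - φ₀)) (ℤ.*-comm (δ s h h) Δ₂))) ⟩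
        ∑< M (λ h → (+ 2 * φ₁ - φ₀) + Δ₂ * δ s h h)
          ≡⟨ ∑-+ (upTo M) (λ _ → + 2 * φ₁ - φ₀) (λ h → Δ₂ * δ s h h) ⟩
        ∑< M (λ _ → + 2 * φ₁ - φ₀) + ∑< M (λ h → Δ₂ * δ s h h)
          ≡⟨ cong₂ _+_ (∑<-const M (+ 2 * φ₁ - φ₀)) (∑-*ˡ (upTo M) Δ₂ (λ h → δ s h h)) ⟩
        + M * (+ 2 * φ₁ - φ₀) + Δ₂ * ∑< M (λ h → δ s h h)
          ≡⟨ cong (_+_ (+ M * (+ 2 * φ₁ - φ₀)))
               (trans (cong (_*_ Δ₂) ∑-δ-diagonal) (ℤ.*-comm Δ₂ (+ M - k - 1ℤ))) ⟩
        + M * (+ 2 * φ₁ - φ₀) + (+ M - k - 1ℤ) * Δ₂ ∎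

      identity : ∀ x k a b c →
        ((1ℤ + x) * ((1ℤ + x) * a)
          + (((1ℤ + x) * (1ℤ + x - k) - (1ℤ + x)) + ((1ℤ + x) * (1ℤ + x - k) - (1ℤ + x))) * (b - a)
          + ((1ℤ + x - k) * (1ℤ + x - k) - + 2 * (1ℤ + x - k) + (1ℤ + x)) * (c - + 2 * b + a))
          + ((1ℤ + x) * (+ 2 * b - a) + (1ℤ + x - k - 1ℤ) * (c - + 2 * b + a)) ≡
        (k * (k + 1ℤ) + x) * a + (+ 2 * ((x - k) * k + 1ℤ)) * b
          + ((x - k) * (x - k + 1ℤ) + x) * c
      identity = solve-∀

-- Inserting 2-cycles into words and deleting them

∑-bijection : {A B : Set} {xs : List A} {ys : List B} (h : A → B) → Unique xs → Unique ys →
              (∀ {x x′} → h x ≡ h x′ → x ≡ x′) →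
              (∀ {x} → x ∈ xs → h x ∈ ys) →
              (∀ {y} → y ∈ ys → ∃[ x ] x ∈ xs × y ≡ h x) →
              (f : B → ℤ) → ∑ ys f ≡ ∑ xs (f ∘ h)
∑-bijection {xs = xs} {ys} h xs! ys! injective into onto f =
  -- Duplicate-free lists with the same members are permutations of each other.
  trans (∑-↭ (∼bag⇒↭ (unique∧set⇒bag ys! (map⁺ injective xs!) (mk⇔ to from))) f) (∑-map h xs f)
  where
  to : ∀ {y} → y ∈ ys → y ∈ map h xs
  to y∈ys with x , x∈xs , refl ← onto y∈ys = ∈-map⁺ h x∈xs
  from : ∀ {y} → y ∈ map h xs → y ∈ ys
  from y∈ with x , x∈xs , refl ← ∈-map⁻ h y∈ = into x∈xs

lookup-injective : ∀ {A : Set} {n} {v w : Vec A n} → (∀ i → lookup v i ≡ lookup w i) → v ≡ w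
lookup-injective {v = v} {w} eq =
  trans (sym (tabulate∘lookup v)) (trans (tabulate-cong eq) (tabulate∘lookup w))

fpfInvolution : ∀ {m} {w : Vec (Fin m) m} → Involutive _≡_ (lookup w) → (∀ i → lookup w i ≢ i) →
                IsFixedPointFreeInvolution w
fpfInvolution {w = w} inv fpf = mkFPFI
  ( (λ {x} {y} eq → trans (sym (inv x)) (trans (cong (lookup w) eq) (inv y)))
  , (λ y → lookup w y , λ { refl → inv y }))
  inv fpf

fpfInvolutions : ∀ m → List (Vec (Fin m) m)
fpfInvolutions m = filter isFixedPointFreeInvolution? (words m m)

module _ {m : ℕ} (a : Fin (suc (suc m))) (b : Fin (suc m)) where

  -- Here `a` is a position of the longer word and `b` numbers its partner `punchIn a b` among the
  -- other positions; `ι` embeds the old letters into what is left.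
  ι : Fin m → Fin (suc (suc m))
  ι i = punchIn a (punchIn b i)

  ι-injective : ∀ {i j} → ι i ≡ ι j → i ≡ j
  ι-injective eq = Fin.punchIn-injective b _ _ (Fin.punchIn-injective a _ _ eq)

  ι≢a : ∀ i → ι i ≢ a
  ι≢a i = Fin.punchInᵢ≢i a (punchIn b i)

  ι≢b : ∀ i → ι i ≢ punchIn a b
  ι≢b i = Fin.punchInᵢ≢i b i ∘ Fin.punchIn-injective a _ _

  Cover : Fin (suc (suc m)) → Set
  Cover x = x ≡ a ⊎ x ≡ punchIn a b ⊎ ∃[ i ] x ≡ ι i

  cover : ∀ x → Cover x
  cover x with a Fin.≟ x
  ... | yes a≡x = inj₁ (sym a≡x)
  ... | no  a≢x with b Fin.≟ punchOut a≢x
  ...   | yes b≡y = inj₂ (inj₁ (sym (trans (cong (punchIn a) b≡y) (Fin.punchIn-punchOut a≢x))))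
  ...   | no  b≢y = inj₂ (inj₂ (punchOut b≢y , sym
    (trans (cong (punchIn a) (Fin.punchIn-punchOut b≢y)) (Fin.punchIn-punchOut a≢x))))

  module _ (w : Vec (Fin m) m) where

    image : ∀ {x} → Cover x → Fin (suc (suc m))
    image (inj₁ _)              = punchIn a b
    image (inj₂ (inj₁ _))       = a
    image (inj₂ (inj₂ (i , _))) = ι (lookup w i)

    insert : Vec (Fin (suc (suc m))) (suc (suc m))
    insert = tabulate (λ x → image (cover x))

    insert-a : lookup insert a ≡ punchIn a b
    insert-a = trans (lookup∘tabulate (λ x → image (cover x)) a) (at (cover a))
      where
      at : (c : Cover a) → image c ≡ punchIn a b
      at (inj₁ _)               = refl
      at (inj₂ (inj₁ a≡b))      = a≡b
      at (inj₂ (inj₂ (i , eq))) = ⊥-elim (ι≢a i (sym eq))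

    insert-b : lookup insert (punchIn a b) ≡ a
    insert-b = trans (lookup∘tabulate (λ x → image (cover x)) (punchIn a b)) (at (cover (punchIn a b)))
      where
      at : (c : Cover (punchIn a b)) → image c ≡ a
      at (inj₁ b≡a)             = b≡a
      at (inj₂ (inj₁ _))        = refl
      at (inj₂ (inj₂ (i , eq))) = ⊥-elim (ι≢b i (sym eq))

    insert-ι : ∀ i → lookup insert (ι i) ≡ ι (lookup w i)
    insert-ι i = trans (lookup∘tabulate (λ x → image (cover x)) (ι i)) (at (cover (ι i)))
      where
      at : (c : Cover (ι i)) → image c ≡ ι (lookup w i)
      at (inj₁ eq)              = ⊥-elim (ι≢a i eq)
      at (inj₂ (inj₁ eq))       = ⊥-elim (ι≢b i eq)
      at (inj₂ (inj₂ (j , eq))) = cong (ι ∘ lookup w) (sym (ι-injective eq))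

    insert-fpf : IsFixedPointFreeInvolution w → IsFixedPointFreeInvolution insert
    insert-fpf (mkFPFI _ inv fpf) = fpfInvolution (λ x → inv⁺ (cover x)) (λ x → fpf⁺ (cover x))
      where
      inv⁺ : ∀ {x} → Cover x → lookup insert (lookup insert x) ≡ x
      inv⁺ (inj₁ refl)              = trans (cong (lookup insert) insert-a) insert-b
      inv⁺ (inj₂ (inj₁ refl))       = trans (cong (lookup insert) insert-b) insert-a
      inv⁺ (inj₂ (inj₂ (i , refl))) = trans (cong (lookup insert) (insert-ι i))
        (trans (insert-ι (lookup w i)) (cong ι (inv i)))
      fpf⁺ : ∀ {x} → Cover x → lookup insert x ≢ x
      fpf⁺ (inj₁ refl) eq              = Fin.punchInᵢ≢i a b (trans (sym insert-a) eq)
      fpf⁺ (inj₂ (inj₁ refl)) eq       = Fin.punchInᵢ≢i a b (trans (sym eq) insert-b)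
      fpf⁺ (inj₂ (inj₂ (i , refl))) eq = fpf i (ι-injective (trans (sym (insert-ι i)) eq))

-- Fixed-point-free involutions with a marked letter

insertMarked : ∀ {m} → Vec (Fin m) m × Fin (suc (suc m)) × Fin (suc m) →
               Vec (Fin (suc (suc m))) (suc (suc m)) × Fin (suc (suc m))
insertMarked (w , a , b) = insert a b w , a

-- The mark recovers `a`, its image recovers `b`, and the images of the remaining letters recover
-- `w`.
insertMarked-injective : ∀ {m} {x y : Vec (Fin m) m × Fin (suc (suc m)) × Fin (suc m)} →
                         insertMarked x ≡ insertMarked y → x ≡ y
insertMarked-injective {x = w , a , b} {w′ , a′ , b′} eq with refl ← cong proj₂ eq
  with refl ← Fin.punchIn-injective a b b′ (trans (sym (insert-a a b w))
         (trans (cong (λ z → lookup (proj₁ z) a) eq) (insert-a a b′ w′)))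
  = cong (_, a , b) (lookup-injective (λ i → ι-injective a b (trans (sym (insert-ι a b w i))
      (trans (cong (λ z → lookup (proj₁ z) (ι a b i)) eq) (insert-ι a b w′ i)))))

module _ {m : ℕ} {v : Vec (Fin (suc (suc m))) (suc (suc m))}
         (v-fpf : IsFixedPointFreeInvolution v) (a : Fin (suc (suc m))) where

  open IsFixedPointFreeInvolution v-fpf

  private
    a≢va : a ≢ lookup v a
    a≢va = fixedPointFree a ∘ sym

    b : Fin (suc m)
    b = punchOut a≢va

    va : punchIn a b ≡ lookup v a
    va = Fin.punchIn-punchOut a≢va

    swap-≡ : ∀ {x y} → lookup v x ≡ y → lookup v y ≡ x
    swap-≡ {x} eq = trans (cong (lookup v) (sym eq)) (involutive x)

    -- If the image were `a` or its partner, applying `v` again would make `ι a b i` the other one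
    -- of these two.
    reduce : ∀ i → ∃[ j ] lookup v (ι a b i) ≡ ι a b j
    reduce i with cover a b (lookup v (ι a b i))
    ... | inj₁ eq        = ⊥-elim (ι≢b a b i (trans (sym (swap-≡ eq)) (sym va)))
    ... | inj₂ (inj₁ eq) = ⊥-elim (ι≢a a b i (trans (sym (swap-≡ eq)) (swap-≡ (sym va))))
    ... | inj₂ (inj₂ r)  = r

  delete : Vec (Fin m) m
  delete = tabulate (proj₁ ∘ reduce)

  private
    v-ι : ∀ i → lookup v (ι a b i) ≡ ι a b (lookup delete i)
    v-ι i = trans (proj₂ (reduce i)) (cong (ι a b) (sym (lookup∘tabulate (proj₁ ∘ reduce) i)))

  delete-fpf : IsFixedPointFreeInvolution delete
  delete-fpf = fpfInvolution
    (λ i → ι-injective a b (trans (sym (v-ι (lookup delete i))) (swap-≡ (v-ι i))))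
    (λ i eq → fixedPointFree (ι a b i) (trans (v-ι i) (cong (ι a b) eq)))

  insertMarked-delete : (v , a) ≡ insertMarked (delete , a , b)
  insertMarked-delete = cong (_, a) (lookup-injective (λ x → at (cover a b x)))
    where
    at : ∀ {x} → Cover a b x → lookup v x ≡ lookup (insert a b delete) x
    at (inj₁ refl)              = trans (sym va) (sym (insert-a a b delete))
    at (inj₂ (inj₁ refl))       = trans (swap-≡ (sym va)) (sym (insert-b a b delete))
    at (inj₂ (inj₂ (i , refl))) = trans (v-ι i) (sym (insert-ι a b delete i))

-- Double counting: the factor on the left is the number of letters that can be marked, and each
-- marked involution comes from exactly one triple `(w , a , b)`.
∑-fpfInvolutions : ∀ m (f : Vec (Fin (suc (suc m))) (suc (suc m)) → ℤ) →
  + suc (suc m) * ∑ (fpfInvolutions (suc (suc m))) f ≡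
  ∑ (fpfInvolutions m) (λ w → ∑ (allFin (suc (suc m))) (λ a → ∑ (allFin (suc m)) (λ b → f (insert a b w))))
∑-fpfInvolutions m f = begin
  + m₂ * ∑ (fpfInvolutions m₂) f
    ≡⟨ ∑-*ˡ (fpfInvolutions m₂) (+ m₂) f ⟨
  ∑ (fpfInvolutions m₂) (λ v → + m₂ * f v)
    ≡⟨ ∑-cong (fpfInvolutions m₂) (λ {v} _ → trans (∑-const (allFin m₂) (f v))
         (cong (λ z → + z * f v) (length-tabulate {n = m₂} id))) ⟨
  ∑ (fpfInvolutions m₂) (λ v → ∑ (allFin m₂) (λ _ → f v))
    ≡⟨ ∑-× (fpfInvolutions m₂) (allFin m₂) (f ∘ proj₁) ⟨
  ∑ (cartesianProduct (fpfInvolutions m₂) (allFin m₂)) (f ∘ proj₁)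
    ≡⟨ ∑-bijection insertMarked
         (cartesianProduct⁺ (unique m) pairs!) (cartesianProduct⁺ (unique m₂) (allFin⁺ m₂))
         insertMarked-injective into onto (f ∘ proj₁) ⟩
  ∑ (cartesianProduct (fpfInvolutions m) pairs) (f ∘ proj₁ ∘ insertMarked)
    ≡⟨ ∑-× (fpfInvolutions m) pairs (f ∘ proj₁ ∘ insertMarked) ⟩
  ∑ (fpfInvolutions m) (λ w → ∑ pairs (λ (a , b) → f (insert a b w)))
    ≡⟨ ∑-cong (fpfInvolutions m) (λ {w} _ →
         ∑-× (allFin m₂) (allFin (suc m)) (λ (a , b) → f (insert a b w))) ⟩
  ∑ (fpfInvolutions m) (λ w → ∑ (allFin m₂) (λ a → ∑ (allFin (suc m)) (λ b → f (insert a b w)))) ∎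
  where
  m₂ : ℕ
  m₂ = suc (suc m)
  pairs : List (Fin m₂ × Fin (suc m))
  pairs = cartesianProduct (allFin m₂) (allFin (suc m))
  pairs! : Unique pairs
  pairs! = cartesianProduct⁺ (allFin⁺ m₂) (allFin⁺ (suc m))
  unique : ∀ n → Unique (fpfInvolutions n)
  unique n = filter⁺ isFixedPointFreeInvolution? (words-unique n n)
  into : ∀ {x} → x ∈ cartesianProduct (fpfInvolutions m) pairs →
         insertMarked x ∈ cartesianProduct (fpfInvolutions m₂) (allFin m₂)
  into {w , a , b} x∈ = ∈-cartesianProduct⁺
    (∈-filter⁺ isFixedPointFreeInvolution? (∈-words (insert a b w)) (insert-fpf a b w
      (proj₂ (∈-filter⁻ isFixedPointFreeInvolution? {xs = words m m}
        (proj₁ (∈-cartesianProduct⁻ (fpfInvolutions m) pairs x∈))))))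
    (∈-allFin a)
  onto : ∀ {y} → y ∈ cartesianProduct (fpfInvolutions m₂) (allFin m₂) →
         ∃[ x ] x ∈ cartesianProduct (fpfInvolutions m) pairs × y ≡ insertMarked x
  onto {v , a} y∈ = _ , ∈-cartesianProduct⁺
      (∈-filter⁺ isFixedPointFreeInvolution? (∈-words (delete v-fpf a)) (delete-fpf v-fpf a))
      (∈-cartesianProduct⁺ (∈-allFin a) (∈-allFin _))
    , insertMarked-delete v-fpf a
    where
    v-fpf : IsFixedPointFreeInvolution v
    v-fpf = proj₂ (∈-filter⁻ isFixedPointFreeInvolution? {xs = words m₂ m₂}
      (proj₁ (∈-cartesianProduct⁻ (fpfInvolutions m₂) (allFin m₂) y∈)))

-- Descents of words

-- The letters are renumbered from 1; ext w fixes the sentinel 0 and everything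
-- above m, so that the gaps are the pairs (i, i + 1) with 0 ≤ i ≤ m.
ext : ∀ {m} → Vec (Fin m) m → ℕ → ℕ
ext     w zero    = zero
ext {m} w (suc x) with x ℕ.<? m
... | yes x<m = suc (toℕ (lookup w (fromℕ< x<m)))
... | no  _   = suc x

ext-toℕ : ∀ {m} (w : Vec (Fin m) m) i → ext w (suc (toℕ i)) ≡ suc (toℕ (lookup w i))
ext-toℕ {m} w i with toℕ i ℕ.<? m
... | yes i<m = cong (suc ∘ toℕ ∘ lookup w) (Fin.fromℕ<-toℕ i i<m)
... | no  i≮m = ⊥-elim (i≮m (Fin.toℕ<n i))

ext-beyond : ∀ {m} (w : Vec (Fin m) m) {x} → m < x → ext w x ≡ x
ext-beyond {m} w {suc x} m<1+x with x ℕ.<? m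
... | yes x<m = ⊥-elim (ℕ.<⇒≱ x<m (s≤s⁻¹ m<1+x))
... | no  _   = refl

data Position (m : ℕ) : ℕ → Set where
  start  : Position m zero
  inside : (i : Fin m) → Position m (suc (toℕ i))
  beyond : ∀ {x} → m < x → Position m x

position : ∀ m x → Position m x
position m zero    = start
position m (suc x) with x ℕ.<? m
... | yes x<m = subst (Position m ∘ suc) (Fin.toℕ-fromℕ< x<m) (inside (fromℕ< x<m))
... | no  x≮m = beyond (s≤s (ℕ.≮⇒≥ x≮m))

ext-fpf : ∀ {m} {w : Vec (Fin m) m} → IsFixedPointFreeInvolution w → FPFInvolution m (ext w)
ext-fpf {m} {w} (mkFPFI _ inv fpf) = record
  { involutive = λ x → inv⁺ (position m x)
  ; zero-fixed = refl
  ; beyond     = ext-beyond w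
  ; moves      = λ {x} x<m → moves⁺ (position m (suc x)) x<m
  }
  where
  inv⁺ : ∀ {x} → Position m x → ext w (ext w x) ≡ x
  inv⁺ start            = refl
  inv⁺ (inside i)       = trans (cong (ext w) (ext-toℕ w i))
    (trans (ext-toℕ w (lookup w i)) (cong (suc ∘ toℕ) (inv i)))
  inv⁺ (beyond m<x)     = trans (cong (ext w) (ext-beyond w m<x)) (ext-beyond w m<x)
  moves⁺ : ∀ {x} → Position m (suc x) → x < m → ext w (suc x) ≢ suc x
  moves⁺ (inside i) _ eq     = fpf i (Fin.toℕ-injective (ℕ.suc-injective (trans (sym (ext-toℕ w i)) eq)))
  moves⁺ (beyond m<x) x<m _  = ℕ.<⇒≱ x<m (s≤s⁻¹ m<x)

-- The sentinels add no descents: the first pair starts with 0 and the last one ends with the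
-- maximum `suc m`.
descents-desc : ∀ {m} (w : Vec (Fin m) m) → + descents w ≡ desc (suc m) (ext w)
descents-desc []            = refl
descents-desc {suc n} w@(_ ∷ _) = begin
  + length (filter (isDescent? w) (allFin n))
    ≡⟨ length-filter-∑ (isDescent? w) (allFin n) ⟩
  ∑ (allFin n) (λ i → ⟦ isDescent? w i ⟧)
    ≡⟨ ∑-cong (allFin n) (λ {i} _ → at i) ⟩
  ∑ (allFin n) (λ i → D (s (suc (toℕ i))) (s (suc (suc (toℕ i)))))
    ≡⟨ ∑-allFin n (λ i → D (s (suc i)) (s (suc (suc i)))) ⟩
  ∑< n (λ i → D (s (suc i)) (s (suc (suc i))))
    -- The two zeros stand for the pairs at the ends; the first holds by computation because `s 0`
    -- is `zero`.
    ≡⟨ pad (∑< n (λ i → D (s (suc i)) (s (suc (suc i))))) ⟩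
  0ℤ + (∑< n (λ i → D (s (suc i)) (s (suc (suc i)))) + 0ℤ)
    ≡⟨ cong (λ z → 0ℤ + (∑< n (λ i → D (s (suc i)) (s (suc (suc i)))) + z)) (sym last) ⟩
  0ℤ + (∑< n (λ i → D (s (suc i)) (s (suc (suc i)))) + D (s (suc n)) (s (suc (suc n))))
    ≡⟨ cong (_+_ 0ℤ) (∑<-suc n (λ i → D (s (suc i)) (s (suc (suc i))))) ⟨
  0ℤ + ∑< (suc n) (λ i → D (s (suc i)) (s (suc (suc i))))
    ≡⟨ cong (_+_ 0ℤ) (trans (cong (λ xs → ∑ xs f) (sym (map-upTo suc (suc n)))) (∑-map suc (upTo (suc n)) f)) ⟨
  desc (suc (suc n)) s ∎
  where
  s : ℕ → ℕ
  s = ext w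
  f : ℕ → ℤ
  f i = D (s i) (s (suc i))
  pad : ∀ x → x ≡ 0ℤ + (x + 0ℤ)
  pad = solve-∀
  last : D (s (suc n)) (s (suc (suc n))) ≡ 0ℤ
  last = cong (_-_ 1ℤ) (L-yes (subst (s (suc n) ≤_) (sym (ext-beyond w ℕ.≤-refl))
    (subst (λ z → s (suc z) ≤ suc (suc n)) (Fin.toℕ-fromℕ n)
      (subst (_≤ suc (suc n)) (sym (ext-toℕ w (fromℕ n))) (ℕ.m≤n⇒m≤1+n (Fin.toℕ<n (lookup w (fromℕ n))))))))
  D-⟦⟧ : ∀ {P : Set} (P? : Dec P) {x y} → (P → y < x) → (y < x → P) → ⟦ P? ⟧ ≡ D x y
  D-⟦⟧ (yes p) to from = cong (_-_ 1ℤ) (sym (L-no (to p)))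
  D-⟦⟧ (no ¬p) to from = cong (_-_ 1ℤ) (sym (L-yes (ℕ.≮⇒≥ (¬p ∘ from))))
  at : ∀ i → ⟦ isDescent? w i ⟧ ≡ D (s (suc (toℕ i))) (s (suc (suc (toℕ i))))
  at i = trans (D-⟦⟧ (isDescent? w i) {suc (toℕ (lookup w (inject₁ i)))} {suc (toℕ (lookup w (suc i)))} s≤s s≤s⁻¹)
    (cong₂ D (trans (sym (ext-toℕ w (inject₁ i))) (cong (s ∘ suc) (Fin.toℕ-inject₁ i))) (sym (ext-toℕ w (suc i))))

skip-toℕ : ∀ {n} (a : Fin (suc n)) i → skip (toℕ a) (suc (toℕ i)) ≡ suc (toℕ (punchIn a i))
skip-toℕ zero    i       = refl
skip-toℕ (suc a) zero    = cong suc refl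
skip-toℕ (suc a) (suc i) = cong suc (skip-toℕ a i)

module _ {m : ℕ} (a : Fin (suc (suc m))) (b : Fin (suc m)) (w : Vec (Fin m) m) where

  private
    t : ℕ → ℕ
    t = ext (insert a b w)

  ext-insert-a : t (suc (toℕ a)) ≡ skip (toℕ a) (suc (toℕ b))
  ext-insert-a = trans (ext-toℕ (insert a b w) a)
    (trans (cong (suc ∘ toℕ) (insert-a a b w)) (sym (skip-toℕ a b)))

  ext-insert-b : t (skip (toℕ a) (suc (toℕ b))) ≡ suc (toℕ a)
  ext-insert-b = trans (cong t (skip-toℕ a b))
    (trans (ext-toℕ (insert a b w) (punchIn a b)) (cong (suc ∘ toℕ) (insert-b a b w)))

  ext-insert-skip : ∀ x → t (skip (toℕ a) (skip (toℕ b) x)) ≡ skip (toℕ a) (skip (toℕ b) (ext w x))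
  ext-insert-skip x = at (position m x)
    where
    skip-ι : ∀ i → skip (toℕ a) (skip (toℕ b) (suc (toℕ i))) ≡ suc (toℕ (ι a b i))
    skip-ι i = trans (cong (skip (toℕ a)) (skip-toℕ b i)) (skip-toℕ a (punchIn b i))
    at : ∀ {x} → Position m x → t (skip (toℕ a) (skip (toℕ b) x)) ≡ skip (toℕ a) (skip (toℕ b) (ext w x))
    at start      = refl
    at (inside i) = trans (cong t (skip-ι i)) (trans (ext-toℕ (insert a b w) (ι a b i))
      (trans (cong (suc ∘ toℕ) (insert-ι a b w i)) (trans (sym (skip-ι (lookup w i)))
        (cong (skip (toℕ a) ∘ skip (toℕ b)) (sym (ext-toℕ w i))))))
    at {x} (beyond m<x) = trans
      (ext-beyond (insert a b w) (subst (suc (suc m) <_) (sym far) (s≤s (s≤s m<x))))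
      (cong (skip (toℕ a) ∘ skip (toℕ b)) (sym (ext-beyond w m<x)))
      where
      far : skip (toℕ a) (skip (toℕ b) x) ≡ suc (suc x)
      far = trans (cong (skip (toℕ a)) (skip-> (ℕ.≤-trans (Fin.toℕ<n b) m<x)))
        (skip-> (ℕ.≤-trans (Fin.toℕ<n a) (s≤s m<x)))

  ext-inserts-≤ : toℕ a ≤ toℕ b → Inserts (toℕ a) (toℕ b) t (ext w)
  ext-inserts-≤ a≤b = record
    { g≤h  = a≤b
    ; at-g = trans ext-insert-a (skip-> (s≤s a≤b))
    ; at-h = trans (cong t (sym (skip-> (s≤s a≤b)))) ext-insert-b
    ; else = ext-insert-skip
    }

  -- The partner comes first, so the gaps trade places, and the position `a` counts the partner, so
  -- its gap is one less. `skip-skip` reconciles the two orders of renaming.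
  ext-inserts-> : ∀ {h} → toℕ a ≡ suc h → toℕ b ≤ h → Inserts (toℕ b) h t (ext w)
  ext-inserts-> {h} a≡1+h b≤h = record
    { g≤h  = b≤h
    ; at-g = trans (cong t (sym b-skipped)) (trans ext-insert-b (cong suc a≡1+h))
    ; at-h = trans (cong (t ∘ suc) (sym a≡1+h)) (trans ext-insert-a b-skipped)
    ; else = λ x → trans (cong t (sym (swapped x))) (trans (ext-insert-skip x) (swapped (ext w x)))
    }
    where
    b-skipped : skip (toℕ a) (suc (toℕ b)) ≡ suc (toℕ b)
    b-skipped = skip-≤ (subst (suc (toℕ b) ≤_) (sym a≡1+h) (s≤s b≤h))
    swapped : ∀ x → skip (toℕ a) (skip (toℕ b) x) ≡ skip (toℕ b) (skip h x)
    swapped x = trans (cong (λ z → skip z (skip (toℕ b) x)) a≡1+h) (skip-skip b≤h x)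

-- Descents created by a marked insertion

module _ (s : ℕ → ℕ) where

  gapIncrease : ℕ → ℕ → ℤ
  gapIncrease g h with g ℕ.≟ h
  ... | yes _ = 1ℤ + δ s g g
  ... | no  _ = δ s g h + δ s h g

  increase : ℕ → ℕ → ℤ
  increase a b with a ℕ.≤? b
  ... | yes _ = gapIncrease a b
  ... | no  _ = gapIncrease b (ℕ.pred a)

  gapIncrease-≡ : ∀ g → gapIncrease g g ≡ 1ℤ + δ s g g
  gapIncrease-≡ g with g ℕ.≟ g
  ... | yes _  = refl
  ... | no g≢g = ⊥-elim (g≢g refl)

  gapIncrease-< : ∀ {g h} → g < h → gapIncrease g h ≡ δ s g h + δ s h g
  gapIncrease-< {g} {h} g<h with g ℕ.≟ h
  ... | yes g≡h = ⊥-elim (ℕ.<⇒≢ g<h g≡h)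
  ... | no  _   = refl

  increase-≤ : ∀ {a b} → a ≤ b → increase a b ≡ gapIncrease a b
  increase-≤ {a} {b} a≤b with a ℕ.≤? b
  ... | yes _  = refl
  ... | no a≰b = ⊥-elim (a≰b a≤b)

  increase-> : ∀ {a b} → b ≤ a → increase (suc a) b ≡ gapIncrease b a
  increase-> {a} {b} b≤a with suc a ℕ.≤? b
  ... | yes a<b = ⊥-elim (ℕ.<⇒≱ a<b b≤a)
  ... | no  _   = refl

  desc-inserts : ∀ {g h n t} → Inserts g h t s → h < n →
                 desc (suc (suc n)) t ≡ desc n s + gapIncrease g h
  desc-inserts {g} {h} {n} ins h<n with ℕ.m≤n⇒m<n∨m≡n (Inserts.g≤h ins)
  ... | inj₁ g<h    = trans (desc-inserts-< ins h<n g<h) (cong (_+_ (desc n s)) (sym (gapIncrease-< g<h)))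
  ... | inj₂ refl = trans (desc-inserts-≡ ins h<n refl) (cong (_+_ (desc n s)) (sym (gapIncrease-≡ g)))

descents-insert : ∀ {m} (a : Fin (suc (suc m))) (b : Fin (suc m)) (w : Vec (Fin m) m) →
                  + descents (insert a b w) ≡ + descents w + increase (ext w) (toℕ a) (toℕ b)
descents-insert {m} a b w = begin
  + descents (insert a b w)                                ≡⟨ descents-desc (insert a b w) ⟩
  desc (suc (suc (suc m))) (ext (insert a b w))            ≡⟨ by-order (toℕ a ℕ.≤? toℕ b) ⟩
  desc (suc m) (ext w) + increase (ext w) (toℕ a) (toℕ b)  ≡⟨ cong (_+ increase (ext w) (toℕ a) (toℕ b)) (descents-desc w) ⟨
  + descents w + increase (ext w) (toℕ a) (toℕ b)          ∎
  where
  predecessor : ∀ {x y} → y < x → ∃[ h ] x ≡ suc h × y ≤ h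
  predecessor (s≤s y≤h) = _ , refl , y≤h
  by-order : Dec (toℕ a ≤ toℕ b) → desc (suc (suc (suc m))) (ext (insert a b w)) ≡
             desc (suc m) (ext w) + increase (ext w) (toℕ a) (toℕ b)
  by-order (yes a≤b) = trans (desc-inserts (ext w) (ext-inserts-≤ a b w a≤b) (Fin.toℕ<n b))
    (cong (_+_ (desc (suc m) (ext w))) (sym (increase-≤ (ext w) a≤b)))
  by-order (no a≰b) with h , a≡1+h , b≤h ← predecessor (ℕ.≰⇒> a≰b) =
    trans (desc-inserts (ext w) (ext-inserts-> a b w a≡1+h b≤h) (s≤s⁻¹ (subst (_< suc (suc m)) a≡1+h (Fin.toℕ<n a))))
      (cong (_+_ (desc (suc m) (ext w)))
        (trans (sym (increase-> (ext w) b≤h)) (cong (λ z → increase (ext w) z (toℕ b)) (sym a≡1+h))))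

∑-insert : ∀ {m} {w : Vec (Fin m) m} → IsFixedPointFreeInvolution w → (φ : ℤ → ℤ) → let k = + descents w in
  ∑ (allFin (suc (suc m))) (λ a → ∑ (allFin (suc m)) (λ b → φ (+ descents (insert a b w)))) ≡
  (k * (k + 1ℤ) + + m) * φ k
    + (+ 2 * ((+ m - k) * k + 1ℤ)) * φ (k + 1ℤ)
    + ((+ m - k) * (+ m - k + 1ℤ) + + m) * φ (k + + 2)
∑-insert {m} {w} w-fpf φ = begin
  ∑ (allFin m₂) (λ a → ∑ (allFin M) (λ b → φ (+ descents (insert a b w))))
    ≡⟨ ∑-swap (allFin m₂) (allFin M) (λ a b → φ (+ descents (insert a b w))) ⟩
  ∑ (allFin M) (λ b → ∑ (allFin m₂) (λ a → φ (+ descents (insert a b w))))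
    ≡⟨ ∑-cong (allFin M) (λ {b} _ → ∑-cong (allFin m₂) (λ {a} _ → cong φ
         (trans (descents-insert a b w) (cong (_+ increase s (toℕ a) (toℕ b)) (descents-desc w))))) ⟩
  ∑ (allFin M) (λ b → ∑ (allFin m₂) (λ a → H (toℕ b) (toℕ a)))
    ≡⟨ ∑-cong (allFin M) (λ {b} _ → ∑-allFin m₂ (H (toℕ b))) ⟩
  ∑ (allFin M) (λ b → ∑< m₂ (H (toℕ b)))
    ≡⟨ ∑-allFin M (λ b → ∑< m₂ (H b)) ⟩
  ∑< M (λ b → ∑< m₂ (H b))
    ≡⟨ ∑<-cong M column ⟩
  ∑< M (λ b → ∑< M (K b) - K b b + (C b + C b))
    ≡⟨ ∑-insertions (ext-fpf w-fpf) φ ⟩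
  F (desc M s)
    ≡⟨ cong F (descents-desc w) ⟨
  F (+ descents w) ∎
  where
  M m₂ : ℕ
  M = suc m
  m₂ = suc M
  s : ℕ → ℕ
  s = ext w
  F : ℤ → ℤ
  F k = (k * (k + 1ℤ) + + m) * φ k
    + (+ 2 * ((+ m - k) * k + 1ℤ)) * φ (k + 1ℤ)
    + ((+ m - k) * (+ m - k + 1ℤ) + + m) * φ (k + + 2)
  k : ℤ
  k = desc M s
  H K : ℕ → ℕ → ℤ
  H b a = φ (k + increase s a b)
  K b a = φ (k + (δ s a b + δ s b a))
  C : ℕ → ℤ
  C b = φ (k + (1ℤ + δ s b b))
  -- The positions `a = b` and `a = suc b` are the two markings of the cycle inside gap `b`; every
  -- other `a` stands for exactly one other gap.
  column : ∀ b → b < M → ∑< m₂ (H b) ≡ ∑< M (K b) - K b b + (C b + C b)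
  column b b<M = trans
    (∑<-insert {h = H b} {k = K b} b<M
      (λ a a<b → cong (φ ∘ _+_ k) (trans (increase-≤ s (ℕ.<⇒≤ a<b)) (gapIncrease-< s a<b)))
      (λ a b<a → cong (φ ∘ _+_ k) (trans (increase-> s (ℕ.<⇒≤ b<a))
        (trans (gapIncrease-< s b<a) (ℤ.+-comm (δ s b a) (δ s a b))))))
    (cong (_+_ (∑< M (K b) - K b b)) (cong₂ _+_
      (cong (φ ∘ _+_ k) (trans (increase-≤ s {b} {b} ℕ.≤-refl) (gapIncrease-≡ s b)))
      (cong (φ ∘ _+_ k) (trans (increase-> s {b} {b} ℕ.≤-refl) (gapIncrease-≡ s b)))))

-- The recurrence and its consequences

-- Indexing by ℤ makes J(m, j) vanish for j < 0, so that the recurrence needs no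
-- boundary cases.
Jℤ : ℕ → ℤ → ℤ
Jℤ m j = ∑ (fpfInvolutions m) (λ w → ⟦ + descents w ℤ.≟ j ⟧)

J≡Jℤ : ∀ m j → + J m j ≡ Jℤ m (+ j)
J≡Jℤ m j = begin
  + J m j
    ≡⟨ length-filter-∑ (λ w → isFixedPointFreeInvolution? w ×-dec (descents w ℕ.≟ j)) (words m m) ⟩
  ∑ (words m m) (λ w → ⟦ isFixedPointFreeInvolution? w ×-dec (descents w ℕ.≟ j) ⟧)
    ≡⟨ ∑-cong (words m m) (λ {w} _ → trans
         (⟦⟧-× (isFixedPointFreeInvolution? w) (descents w ℕ.≟ j))
         (cong (_*_ ⟦ isFixedPointFreeInvolution? w ⟧)
           (⟦⟧-cong (descents w ℕ.≟ j) (+ descents w ℤ.≟ + j) (cong (λ x → + x)) ℤ.+-injective))) ⟩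
  ∑ (words m m) (λ w → ⟦ isFixedPointFreeInvolution? w ⟧ * ⟦ + descents w ℤ.≟ + j ⟧)
    ≡⟨ ∑-filter isFixedPointFreeInvolution? (words m m) (λ w → ⟦ + descents w ℤ.≟ + j ⟧) ⟨
  Jℤ m (+ j) ∎

Jℤ-negative : ∀ m {j} → j ℤ.< 0ℤ → Jℤ m j ≡ 0ℤ
Jℤ-negative m {j} j<0 = trans
  (∑-cong (fpfInvolutions m) (λ {w} _ → ⟦⟧-no (+ descents w ℤ.≟ j)
    (λ eq → ℤ.<⇒≱ j<0 (subst (0ℤ ℤ.≤_) eq (+≤+ z≤n)))))
  (trans (∑-const (fpfInvolutions m) 0ℤ) (ℤ.*-zeroʳ (+ length (fpfInvolutions m))))

∑-nonneg : {A : Set} (xs : List A) {f : A → ℤ} → (∀ x → 0ℤ ℤ.≤ f x) → 0ℤ ℤ.≤ ∑ xs f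
∑-nonneg []       0≤f = ℤ.≤-refl
∑-nonneg (x ∷ xs) 0≤f = ℤ.+-mono-≤ (0≤f x) (∑-nonneg xs 0≤f)

⟦⟧-nonneg : {P : Set} (P? : Dec P) → 0ℤ ℤ.≤ ⟦ P? ⟧
⟦⟧-nonneg (yes _) = +≤+ z≤n
⟦⟧-nonneg (no  _) = ℤ.≤-refl

Jℤ-nonneg : ∀ m j → 0ℤ ℤ.≤ Jℤ m j
Jℤ-nonneg m j = ∑-nonneg (fpfInvolutions m) (λ w → ⟦⟧-nonneg (+ descents w ℤ.≟ j))

-- The numbers of marked insertions that create 0, 1 and 2 descents in an involution of `m` letters
-- with `k` descents.
c₀ c₁ c₂ : ℤ → ℤ → ℤ
c₀ m k = k * (k + 1ℤ) + m
c₁ m k = + 2 * ((m - k) * k + 1ℤ)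
c₂ m k = (m - k) * (m - k + 1ℤ) + m

-- The insertion count is applied to the indicator of `j`, so that only involutions with `j`,
-- `j - 1` or `j - 2` descents contribute.
Jℤ-recurrence : ∀ m j → + suc (suc m) * Jℤ (suc (suc m)) j ≡
  c₀ (+ m) j * Jℤ m j + c₁ (+ m) (j - 1ℤ) * Jℤ m (j - 1ℤ) + c₂ (+ m) (j - + 2) * Jℤ m (j - + 2)
Jℤ-recurrence m j = begin
  + suc (suc m) * Jℤ (suc (suc m)) j
    ≡⟨ ∑-fpfInvolutions m (λ v → φ (+ descents v)) ⟩
  ∑ ws (λ w → ∑ (allFin (suc (suc m))) (λ a → ∑ (allFin (suc m)) (λ b → φ (+ descents (insert a b w)))))
    ≡⟨ ∑-cong ws (λ {w} w∈ → trans
         (∑-insert (proj₂ (∈-filter⁻ isFixedPointFreeInvolution? {xs = words m m} w∈)) φ)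
         (cong₂ _+_ (cong₂ _+_ (evaluate (c₀ (+ m)) (+ descents w) j) (shift (c₁ (+ m)) (+ descents w) 1ℤ))
                    (shift (c₂ (+ m)) (+ descents w) (+ 2)))) ⟩
  ∑ ws (λ w → c₀ (+ m) j * χ j w + c₁ (+ m) (j - 1ℤ) * χ (j - 1ℤ) w + c₂ (+ m) (j - + 2) * χ (j - + 2) w)
    ≡⟨ trans (∑-+ ws (λ w → c₀ (+ m) j * χ j w + c₁ (+ m) (j - 1ℤ) * χ (j - 1ℤ) w) _)
         (cong₂ _+_ (trans (∑-+ ws (λ w → c₀ (+ m) j * χ j w) _)
                      (cong₂ _+_ (∑-*ˡ ws (c₀ (+ m) j) (χ j)) (∑-*ˡ ws (c₁ (+ m) (j - 1ℤ)) (χ (j - 1ℤ)))))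
                    (∑-*ˡ ws (c₂ (+ m) (j - + 2)) (χ (j - + 2)))) ⟩
  c₀ (+ m) j * Jℤ m j + c₁ (+ m) (j - 1ℤ) * Jℤ m (j - 1ℤ) + c₂ (+ m) (j - + 2) * Jℤ m (j - + 2) ∎
  where
  ws : List (Vec (Fin m) m)
  ws = fpfInvolutions m
  φ : ℤ → ℤ
  φ k = ⟦ k ℤ.≟ j ⟧
  χ : ℤ → Vec (Fin m) m → ℤ
  χ i w = ⟦ + descents w ℤ.≟ i ⟧
  -- This frees the coefficient from the summation variable, so that it can be moved out of the sum.
  evaluate : ∀ (c : ℤ → ℤ) k i → c k * ⟦ k ℤ.≟ i ⟧ ≡ c i * ⟦ k ℤ.≟ i ⟧
  evaluate c k i with k ℤ.≟ i
  ... | yes k≡i = cong (λ z → c z * 1ℤ) k≡i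
  ... | no  _   = trans (ℤ.*-zeroʳ (c k)) (sym (ℤ.*-zeroʳ (c i)))
  cancel-+ : ∀ a b → a ≡ (a + b) - b
  cancel-+ = solve-∀
  cancel-- : ∀ a b → (a - b) + b ≡ a
  cancel-- = solve-∀
  shift : ∀ (c : ℤ → ℤ) k e → c k * φ (k + e) ≡ c (j - e) * ⟦ k ℤ.≟ j - e ⟧
  shift c k e = trans
    (cong (_*_ (c k)) (⟦⟧-cong (k + e ℤ.≟ j) (k ℤ.≟ j - e)
      (λ eq → trans (cancel-+ k e) (cong (_- e) eq))
      (λ eq → trans (cong (_+ e) eq) (cancel-- j e))))
    (evaluate c k (j - e))

-- Replacing `j` by `m + 2 - j` in the recurrence exchanges the outer coefficients and preserves the
-- middle one. The empty word, with 0 descents, starts the induction.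
Jℤ-symmetric : ∀ n j → Jℤ (2 ℕ.* n) j ≡ Jℤ (2 ℕ.* n) (+ (2 ℕ.* n) - j)
Jℤ-symmetric zero    j = cong (_+ 0ℤ) (⟦⟧-cong (0ℤ ℤ.≟ j) (0ℤ ℤ.≟ 0ℤ - j)
  (λ { refl → refl })
  (λ eq → trans (cong (_-_ 0ℤ) eq) (double-negation j)))
  where
  double-negation : ∀ x → 0ℤ - (0ℤ - x) ≡ x
  double-negation = solve-∀
Jℤ-symmetric (suc n) j = subst (λ z → Jℤ z j ≡ Jℤ z (+ z - j)) (sym (ℕ.*-suc 2 n))
  (ℤ.*-cancelˡ-≡ (+ suc (suc m)) _ _ (begin
    + suc (suc m) * Jℤ (suc (suc m)) j
      ≡⟨ Jℤ-recurrence m j ⟩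
    c₀ (+ m) j * Jℤ m j + c₁ (+ m) (j - 1ℤ) * Jℤ m (j - 1ℤ) + c₂ (+ m) (j - + 2) * Jℤ m (j - + 2)
      ≡⟨ cong₂ _+_ (cong₂ _+_ (cong (_*_ (c₀ (+ m) j)) (reflect j (i - + 2) (shift₂ (+ m) j)))
                              (cong (_*_ (c₁ (+ m) (j - 1ℤ))) (reflect (j - 1ℤ) (i - 1ℤ) (shift₁ (+ m) j))))
                   (cong (_*_ (c₂ (+ m) (j - + 2))) (reflect (j - + 2) i (shift₀ (+ m) j))) ⟩
    c₀ (+ m) j * Jℤ m (i - + 2) + c₁ (+ m) (j - 1ℤ) * Jℤ m (i - 1ℤ) + c₂ (+ m) (j - + 2) * Jℤ m i
      ≡⟨ coefficients (+ m) j (Jℤ m (i - + 2)) (Jℤ m (i - 1ℤ)) (Jℤ m i) ⟩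
    c₀ (+ m) i * Jℤ m i + c₁ (+ m) (i - 1ℤ) * Jℤ m (i - 1ℤ) + c₂ (+ m) (i - + 2) * Jℤ m (i - + 2)
      ≡⟨ Jℤ-recurrence m i ⟨
    + suc (suc m) * Jℤ (suc (suc m)) i ∎))
  where
  m : ℕ
  m = 2 ℕ.* n
  i : ℤ
  i = + suc (suc m) - j
  reflect : ∀ x y → + m - x ≡ y → Jℤ m x ≡ Jℤ m y
  reflect x y eq = trans (Jℤ-symmetric n x) (cong (Jℤ m) eq)
  shift₀ : ∀ m j → m - (j - + 2) ≡ + 2 + m - j
  shift₀ = solve-∀
  shift₁ : ∀ m j → m - (j - 1ℤ) ≡ + 2 + m - j - 1ℤ
  shift₁ = solve-∀
  shift₂ : ∀ m j → m - j ≡ + 2 + m - j - + 2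
  shift₂ = solve-∀
  coefficients : ∀ m j x y z →
    (j * (j + 1ℤ) + m) * x + (+ 2 * ((m - (j - 1ℤ)) * (j - 1ℤ) + 1ℤ)) * y
      + ((m - (j - + 2)) * (m - (j - + 2) + 1ℤ) + m) * z ≡
    ((+ 2 + m - j) * (+ 2 + m - j + 1ℤ) + m) * z
      + (+ 2 * ((m - (+ 2 + m - j - 1ℤ)) * (+ 2 + m - j - 1ℤ) + 1ℤ)) * y
      + ((m - (+ 2 + m - j - + 2)) * (m - (+ 2 + m - j - + 2) + 1ℤ) + m) * x
  coefficients = solve-∀

-- Monotonicity up to the middle

0≤-* : ∀ {x y} → 0ℤ ℤ.≤ x → 0ℤ ℤ.≤ y → 0ℤ ℤ.≤ x * y
0≤-* {+ a} {+ b} _ _ = subst (0ℤ ℤ.≤_) (ℤ.pos-* a b) (+≤+ z≤n)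

0≤-+ : ∀ {x y} → 0ℤ ℤ.≤ x → 0ℤ ℤ.≤ y → 0ℤ ℤ.≤ x + y
0≤-+ = ℤ.+-mono-≤

0≤pos : ∀ {a} → 0ℤ ℤ.≤ + a
0≤pos = +≤+ z≤n

-- Only at `i = 0` are both factors negative. The product is the coefficient left over at the middle
-- index.
consecutive-nonneg : ∀ i → 0ℤ ℤ.≤ (+ i - 1ℤ) * (+ i - + 2)
consecutive-nonneg zero          = 0≤pos
consecutive-nonneg (suc zero)    = 0≤pos
consecutive-nonneg (suc (suc i)) = 0≤-* {+ suc i} {+ i} 0≤pos 0≤pos

-- For `j ≤ 0` the left side vanishes; otherwise induction on `n`. The inductive step is separate so
-- that the number of letters has the form `suc (suc m)`.
Jℤ-increasing : ∀ n j → j ℤ.≤ + n → Jℤ (2 ℕ.* n) (j - 1ℤ) ℤ.≤ Jℤ (2 ℕ.* n) j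
Jℤ-increasing-suc : ∀ n i → i ≤ n →
  Jℤ (suc (suc (2 ℕ.* n))) (+ suc i - 1ℤ) ℤ.≤ Jℤ (suc (suc (2 ℕ.* n))) (+ suc i)

Jℤ-increasing n       -[1+ i ]  _         = ℤ.≤-trans
  (ℤ.≤-reflexive (Jℤ-negative (2 ℕ.* n) { -[1+ i ] - 1ℤ} ℤ.-<+)) (Jℤ-nonneg (2 ℕ.* n) -[1+ i ])
Jℤ-increasing n       (+ zero)  _         = ℤ.≤-trans
  (ℤ.≤-reflexive (Jℤ-negative (2 ℕ.* n) {0ℤ - 1ℤ} ℤ.-<+)) (Jℤ-nonneg (2 ℕ.* n) 0ℤ)
Jℤ-increasing zero    (+ suc i) (+≤+ ())
Jℤ-increasing (suc n) (+ suc i) (+≤+ i<n) =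
  subst (λ z → Jℤ z (+ suc i - 1ℤ) ℤ.≤ Jℤ z (+ suc i)) (sym (ℕ.*-suc 2 n)) (Jℤ-increasing-suc n i (s≤s⁻¹ i<n))

-- After multiplication by `m + 2`, the difference of two consecutive instances of the recurrence
-- has to be nonnegative.
Jℤ-increasing-suc n i i≤n = ℤ.*-cancelˡ-≤-pos _ _ (+ suc (suc m)) (ℤ.0≤i-j⇒j≤i (subst (0ℤ ℤ.≤_) (sym difference)
  (by-cases (ℕ.m≤n⇒m<n∨m≡n i≤n))))
  where
  m : ℕ
  m = 2 ℕ.* n
  j x₀ x₁ x₂ x₃ : ℤ
  j  = + suc i
  x₃ = Jℤ m j
  x₂ = Jℤ m (j - 1ℤ)
  x₁ = Jℤ m (j - + 2)
  x₀ = Jℤ m (j - + 2 - 1ℤ)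

  pred-pred : ∀ x → x - 1ℤ - 1ℤ ≡ x - + 2
  pred-pred = solve-∀
  pred-comm : ∀ x → x - 1ℤ - + 2 ≡ x - + 2 - 1ℤ
  pred-comm = solve-∀

  difference : + suc (suc m) * Jℤ (suc (suc m)) j - + suc (suc m) * Jℤ (suc (suc m)) (j - 1ℤ) ≡
    (c₀ (+ m) j * x₃ + c₁ (+ m) (j - 1ℤ) * x₂ + c₂ (+ m) (j - + 2) * x₁)
    - (c₀ (+ m) (j - 1ℤ) * x₂ + c₁ (+ m) (j - + 2) * x₁ + c₂ (+ m) (j - + 2 - 1ℤ) * x₀)
  difference = cong₂ _-_ (Jℤ-recurrence m j) (trans (Jℤ-recurrence m (j - 1ℤ))
    (cong₂ (λ y z → c₀ (+ m) (j - 1ℤ) * x₂ + c₁ (+ m) y * Jℤ m y + c₂ (+ m) z * Jℤ m z)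
      (pred-pred j) (pred-comm j)))

  -- The three coefficients of the recurrence add up to `(m + 2) * (m + 3)` for every `j`, so two
  -- consecutive instances differ by a combination of differences of neighbouring values.
  by-parts : ∀ m j x₃ x₂ x₁ x₀ →
    ((j * (j + 1ℤ) + m) * x₃ + (+ 2 * ((m - (j - 1ℤ)) * (j - 1ℤ) + 1ℤ)) * x₂
        + ((m - (j - + 2)) * (m - (j - + 2) + 1ℤ) + m) * x₁)
    - (((j - 1ℤ) * (j - 1ℤ + 1ℤ) + m) * x₂ + (+ 2 * ((m - (j - + 2)) * (j - + 2) + 1ℤ)) * x₁
        + ((m - (j - + 2 - 1ℤ)) * (m - (j - + 2 - 1ℤ) + 1ℤ) + m) * x₀) ≡
    (j * (j + 1ℤ) + m) * (x₃ - x₂)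
    + (+ 2 * j + + 2 * ((m - (j - 1ℤ)) * (j - 1ℤ) + 1ℤ)) * (x₂ - x₁)
    + ((m - (j - + 2 - 1ℤ)) * (m - (j - + 2 - 1ℤ) + 1ℤ) + m) * (x₁ - x₀)
  by-parts = solve-∀

  -- At the middle the induction hypothesis does not reach `x₃ - x₂`. With `x₃ = x₁` this difference
  -- is the negative of `x₂ - x₁`, and the net coefficient is a product of consecutive integers.
  by-parts-middle : ∀ i x₂ x₁ x₀ → let m = + 2 * i; j = 1ℤ + i in
    ((j * (j + 1ℤ) + m) * x₁ + (+ 2 * ((m - (j - 1ℤ)) * (j - 1ℤ) + 1ℤ)) * x₂
        + ((m - (j - + 2)) * (m - (j - + 2) + 1ℤ) + m) * x₁)
    - (((j - 1ℤ) * (j - 1ℤ + 1ℤ) + m) * x₂ + (+ 2 * ((m - (j - + 2)) * (j - + 2) + 1ℤ)) * x₁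
        + ((m - (j - + 2 - 1ℤ)) * (m - (j - + 2 - 1ℤ) + 1ℤ) + m) * x₀) ≡
    ((i - 1ℤ) * (i - + 2)) * (x₂ - x₁)
    + ((m - (j - + 2 - 1ℤ)) * (m - (j - + 2 - 1ℤ) + 1ℤ) + m) * (x₁ - x₀)
  by-parts-middle = solve-∀

  0≤x₂-x₁ : 0ℤ ℤ.≤ x₂ - x₁
  0≤x₂-x₁ = ℤ.i≤j⇒0≤j-i (subst (λ z → Jℤ m z ℤ.≤ x₂) (pred-pred j) (Jℤ-increasing n (j - 1ℤ) (+≤+ i≤n)))

  0≤x₁-x₀ : 0ℤ ℤ.≤ x₁ - x₀
  0≤x₁-x₀ = ℤ.i≤j⇒0≤j-i (Jℤ-increasing n (j - + 2) (ℤ.≤-trans (subst (ℤ._≤ + i) (pred-pred j) (ℤ.i-j≤i (+ i) 1ℤ)) (+≤+ i≤n)))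

  0≤m-i : 0ℤ ℤ.≤ + m - + i
  0≤m-i = ℤ.i≤j⇒0≤j-i (+≤+ (ℕ.≤-trans i≤n (ℕ.m≤m+n n _)))

  0≤c₂ : 0ℤ ℤ.≤ c₂ (+ m) (j - + 2 - 1ℤ)
  0≤c₂ = 0≤-+ (0≤-* 0≤m-j+3 (0≤-+ 0≤m-j+3 0≤pos)) 0≤pos
    where
    move : ∀ m i → m - i + + 2 ≡ m - (1ℤ + i - + 2 - 1ℤ)
    move = solve-∀
    0≤m-j+3 : 0ℤ ℤ.≤ + m - (j - + 2 - 1ℤ)
    0≤m-j+3 = subst (0ℤ ℤ.≤_) (move (+ m) (+ i)) (0≤-+ 0≤m-i 0≤pos)

  -- For i = n the outer values x₃ and x₁ agree by symmetry.
  by-cases : i < n ⊎ i ≡ n → 0ℤ ℤ.≤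
    (c₀ (+ m) j * x₃ + c₁ (+ m) (j - 1ℤ) * x₂ + c₂ (+ m) (j - + 2) * x₁)
    - (c₀ (+ m) (j - 1ℤ) * x₂ + c₁ (+ m) (j - + 2) * x₁ + c₂ (+ m) (j - + 2 - 1ℤ) * x₀)
  by-cases (inj₁ i<n) = subst (0ℤ ℤ.≤_) (sym (by-parts (+ m) j x₃ x₂ x₁ x₀))
    (0≤-+ (0≤-+ (0≤-* (0≤-+ (0≤-* {j} {j + 1ℤ} 0≤pos 0≤pos) 0≤pos) 0≤x₃-x₂)
                (0≤-* (0≤-+ (0≤-* {+ 2} {j} 0≤pos 0≤pos)
                            (0≤-* {+ 2} 0≤pos (0≤-+ (0≤-* {y = + i} 0≤m-i 0≤pos) 0≤pos))) 0≤x₂-x₁))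
          (0≤-* 0≤c₂ 0≤x₁-x₀))
    where
    0≤x₃-x₂ : 0ℤ ℤ.≤ x₃ - x₂
    0≤x₃-x₂ = ℤ.i≤j⇒0≤j-i (Jℤ-increasing n j (+≤+ i<n))
  by-cases (inj₂ refl) = subst (0ℤ ℤ.≤_) (sym (trans (cong₂ F (ℤ.pos-* 2 i) x₃≡x₁)
      (by-parts-middle (+ i) x₂ x₁ x₀)))
    (0≤-+ (0≤-* (consecutive-nonneg i) 0≤x₂-x₁)
          (0≤-* (subst (λ z → 0ℤ ℤ.≤ c₂ z (j - + 2 - 1ℤ)) (ℤ.pos-* 2 i) 0≤c₂) 0≤x₁-x₀))
    where
    F : ℤ → ℤ → ℤ
    F m x = (c₀ m j * x + c₁ m (j - 1ℤ) * x₂ + c₂ m (j - + 2) * x₁)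
            - (c₀ m (j - 1ℤ) * x₂ + c₁ m (j - + 2) * x₁ + c₂ m (j - + 2 - 1ℤ) * x₀)
    mirror : ∀ x → + 2 * x - (1ℤ + x) ≡ 1ℤ + x - + 2
    mirror = solve-∀
    x₃≡x₁ : x₃ ≡ x₁
    x₃≡x₁ = trans (Jℤ-symmetric i j)
      (cong (Jℤ m) (trans (cong (_- j) (ℤ.pos-* 2 i)) (mirror (+ i))))

-- Unimodality with the peak at the middle index

theorem3p2 : ∀ (n : ℕ) → n ≥ 1 → Unimodal (J (2 ℕ.* n)) 1 (2 ℕ.* n ℕ.∸ 1)
-- The peak is `n`; in its upper bound, `2 * n - 1` unfolds to `p + (n + 0)`.
theorem3p2 n@(suc p) n≥1 = n , (n≥1 , ℕ.≤-trans (ℕ.m≤m+n n 0) (ℕ.m≤n+m (n ℕ.+ 0) p)) , rising , falling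
  where
  m : ℕ
  m = 2 ℕ.* n
  cast : ∀ {x y} → Jℤ m (+ x) ℤ.≤ Jℤ m (+ y) → J m x ≤ J m y
  cast {x} {y} le = ℤ.drop‿+≤+ (subst₂ ℤ._≤_ (sym (J≡Jℤ m x)) (sym (J≡Jℤ m y)) le)
  rising : ∀ i → 1 ≤ i → i < n → J m i ≤ J m (suc i)
  rising i _ i<n = cast (Jℤ-increasing n (+ suc i) (+≤+ i<n))
  falling : ∀ i → n ≤ i → i < m ℕ.∸ 1 → J m i ≥ J m (suc i)
  -- Symmetry turns the step from `i` to `suc i` into the step from `m - i` down to `m - i - 1`,
  -- which lies in the rising half because `n ≤ i`.
  falling i n≤i _ = cast (subst₂ ℤ._≤_
    (trans (cong (Jℤ m) (regroup (+ m) (+ i))) (sym (Jℤ-symmetric n (+ suc i))))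
    (sym (Jℤ-symmetric n (+ i)))
    (Jℤ-increasing n (+ m - + i) m-i≤n))
    where
    regroup : ∀ m i → m - i - 1ℤ ≡ m - (1ℤ + i)
    regroup = solve-∀
    halve : ∀ x → + 2 * x - x ≡ x
    halve = solve-∀
    m-i≤n : + m - + i ℤ.≤ + n
    m-i≤n = ℤ.≤-trans (ℤ.+-monoʳ-≤ (+ m) (ℤ.neg-mono-≤ (+≤+ n≤i)))
      (ℤ.≤-reflexive (trans (cong (_- + n) (ℤ.pos-* 2 n)) (halve (+ n))))
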